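{- For every $C>0$ and every $\varepsilon>0$ there exist constants $p_0$ and $c>0$, depending only on $C$ and $\varepsilon$, such that for every prime $p\ge p_0$, every integer $M$ with $1\le M\le p$ and $M\le C p^{1/8}$, every integer $\lambda$ with $\gcd(\lambda,p)=1$, and every integer $L$, $$I_3(M;L)\le c\,M^{\varepsilon}.$$
   Context: For a prime $p$, integers $L,\lambda$ with $\gcd(\lambda,p)=1$ and an integer $1\le M\le p$, $I_3(M;L)$ denotes the number of triples of integers $(x,y,z)$ with $xyz\equiv\lambda\pmod p$ and $L+1\le x,y,z\le L+M$. -}

module Defs where

open import Algebra.Definitions.RawSemiring using (_^_)
open import Data.Integer.Base as ℤ using (ℤ; +_)
open import Data.Integer.Divisibility.Signed using (_∣_; _∣?_)
open import Data.List.Base using (List; map; upTo; filter; length; cartesianProduct)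
open import Data.Nat.Base using (ℕ; suc)
open import Data.Product.Base using (∃; ∃₂; _×_; _,_)
open import Data.Rational.Base using (ℚ; 0ℚ; 1ℚ; _<_; _≤_; _/_; _+_; _-_; _*_; +-*-rawSemiring)
import Data.Rational.Properties as ℚ
open import Data.Sum.Base using (_⊎_; inj₁; inj₂)
open import Level using (0ℓ)
open import Relation.Binary.Definitions using (tri<; tri≈; tri>)
open import Relation.Binary.PropositionalEquality using (refl; subst)
open import Relation.Nullary using (¬_; Dec)
open import Relation.Unary using (Pred)

------------------------------------------------------------------------
-- Dedekind reals

-- lower q means q < x, upper q means x < q.
record ℝ : Set₁ where
  field
    lower upper   : Pred ℚ 0ℓ
    lower-inhab   : ∃ lower
    upper-inhab   : ∃ upper
    lower-closed  : ∀ {q r} → q < r → lower r → lower q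
    upper-closed  : ∀ {q r} → q < r → upper q → upper r
    lower-open    : ∀ {q} → lower q → ∃ λ r → q < r × lower r
    upper-open    : ∀ {r} → upper r → ∃ λ q → q < r × upper q
    disjoint      : ∀ {q} → ¬ (lower q × upper q)
    located       : ∀ {q r} → q < r → lower q ⊎ upper r

open ℝ public

Positive : ℝ → Set
Positive x = lower x 0ℚ

private
  q-1<q : ∀ q → q - 1ℚ < q
  q-1<q q = subst (q - 1ℚ <_) (ℚ.+-identityʳ q)
              (ℚ.+-monoʳ-< q (ℚ.negative⁻¹ (ℤ.- (+ 1) / 1)))

  q<q+1 : ∀ q → q < q + 1ℚ
  q<q+1 q = subst (_< q + 1ℚ) (ℚ.+-identityʳ q)
              (ℚ.+-monoʳ-< q (ℚ.positive⁻¹ 1ℚ))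

fromℚ : ℚ → ℝ
fromℚ s = record
  { lower        = _< s
  ; upper        = s <_
  ; lower-inhab  = s - 1ℚ , q-1<q s
  ; upper-inhab  = s + 1ℚ , q<q+1 s
  ; lower-closed = ℚ.<-trans
  ; upper-closed = λ q<r s<q → ℚ.<-trans s<q q<r
  ; lower-open   = λ q<s → let m , q<m , m<s = ℚ.<-dense q<s in m , q<m , m<s
  ; upper-open   = λ s<r → let m , s<m , m<r = ℚ.<-dense s<r in m , m<r , s<m
  ; disjoint     = λ (q<s , s<q) → ℚ.<-asym q<s s<q
  ; located      = loc
  }
  where
  loc : ∀ {q r} → q < r → (q < s) ⊎ (s < r)
  loc {q} q<r with ℚ.<-cmp q s
  ... | tri< q<s _ _    = inj₁ q<s
  ... | tri≈ _ refl _   = inj₂ q<r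
  ... | tri> _ _ s<q    = inj₂ (ℚ.<-trans s<q q<r)

------------------------------------------------------------------------
-- Upper bounds of the form c · nᵉ

-- To bound a natural number from above by a real, it suffices to know the
-- rationals exceeding that real, so products and powers are given by their
-- upper cuts only.
UpperCut : Set₁
UpperCut = Pred ℚ 0ℓ

infix  4 _≤ᵘ_
infixr 7 _*ᵘ_
infixr 8 _^ᵘ_

-- { r | nᵉ < r }, for n ≥ 1 and e ≥ 0 only: nᵉ is the infimum of the rational
-- powers n^(a/(1+b)) with a/(1+b) > e, and n^(a/(1+b)) < r is stated
-- as nᵃ < r^(1+b).  The condition 0 < r matters when 1+b is even.
_^ᵘ_ : ℕ → ℝ → UpperCut
(n ^ᵘ e) r = 0ℚ < r ×
  ∃₂ λ (a b : ℕ) → upper e (+ a / suc b) × ((+ n / 1) ^ℚ a) < (r ^ℚ suc b)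
  where _^ℚ_ = _^_ +-*-rawSemiring

-- { r | c · x < r }, for c > 0 and x > 0 only.
_*ᵘ_ : ℝ → UpperCut → UpperCut
(c *ᵘ x) r = ∃₂ λ s t → upper c s × x t × s * t ≤ r

_≤ᵘ_ : ℕ → UpperCut → Set
n ≤ᵘ x = ∀ r → x r → + n / 1 ≤ r

------------------------------------------------------------------------
-- Points on the modular hyperbola xyz ≡ λ (mod p)

infix 4 _≡_[mod_]

_≡_[mod_] : ℤ → ℤ → ℕ → Set
a ≡ b [mod p ] = + p ∣ a ℤ.- b

_≡?_[mod_] : ∀ a b p → Dec (a ≡ b [mod p ])
a ≡? b [mod p ] = + p ∣? a ℤ.- b

-- The integers L+1, …, L+M.
interval : ℕ → ℤ → List ℤ
interval M L = map (λ i → L ℤ.+ + suc i) (upTo M)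

I₃ : (p : ℕ) (l : ℤ) (M : ℕ) (L : ℤ) → ℕ
I₃ p l M L = length
  (filter (λ (x , y , z) → (x ℤ.* y ℤ.* z) ≡? l [mod p ])
    (cartesianProduct J (cartesianProduct J J)))
  where J = interval M L

{-# OPTIONS --safe #-}
module Submission where

-- Cut the interval into K pieces, K depending on C only, and count the triples
-- L + v with all coordinates in given pieces.  Let d = (d₀, d₁, d₂) be the
-- coefficients of the difference of (T + x)(T + y)(T + z) for two such v; then
-- d₀ + d₁L + d₂L² ≡ 0 modulo p.  If the vectors d are not all parallel, let
-- (A, B, D) be the cross product of two of them.  It is proportional to
-- (1, L, L²) modulo p, and for large K the integers B² - AD and A d₀ + B d₁ + D d₂,
-- of order at most M⁸/K⁴, are smaller than p, hence vanish.  So all differences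
-- have the root B/A, the product of the A x + B over the coordinates x of v
-- does not depend on v, and A x + B divides a fixed nonzero integer.  If all d
-- are multiples of one quadratic polynomial q, then q(-x) divides, up to a
-- factor, the resultant of q with one of the cubics; when that resultant is
-- zero, q splits off a linear factor, and the other factor serves instead.
-- Either way the divisor bound leaves M^o(1) values for each coordinate.

open import Defs
open import Data.List.Base using (List; []; _∷_; map; _++_; length; cartesianProductWith; cartesianProduct; concatMap; filter; upTo)
open import Data.List.Membership.Propositional using (_∈_; find; lose)
open import Data.List.Membership.Propositional.Properties
open import Data.List.Properties using (length-map; length-++; length-upTo)
open import Data.List.Relation.Unary.All as All using (All; []; _∷_)
open import Data.List.Relation.Unary.AllPairs using ([]; _∷_)
open import Data.List.Relation.Unary.Any using (Any; here; there; any?)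
open import Data.List.Relation.Unary.Unique.Propositional using (Unique)
import Data.List.Relation.Unary.Unique.Propositional.Properties as Unique
open import Data.Nat.Base as ℕ using (ℕ; zero; suc; _≤_; _<_; z≤n; s≤s; _^_; _⊔_; NonZero; >-nonZero)
open import Data.Nat.DivMod using (m≡m%n+[m/n]*n; m%n<n; m/n*n≤m; m/n≤m; m<n*o⇒m/o<n)
open import Data.Nat.Primality using (Prime; _Rough_; euclidsLemma; prime⇒nonZero; prime⇒nonTrivial; ¬prime[1]; 2-rough; rough⇒≤; rough∧∣⇒rough; rough∧∣⇒prime; ∤⇒rough-suc)
open import Data.Product.Base using (∃; ∃₂; _×_; _,_; proj₁; proj₂)
open import Data.Product.Properties using (≡-dec)
open import Data.Sum.Base using (_⊎_; inj₁; inj₂; [_,_]′)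
open import Function.Base using (_∘_; id)
open import Relation.Binary.Definitions using (tri<; tri≈; tri>)
open import Relation.Binary.PropositionalEquality
open import Relation.Nullary using (¬_; Dec; yes; no; contradiction)
open import Relation.Nullary.Decidable using (decidable-stable; ¬?)

-- Divisors of a natural number

module _ where

  open import Data.Nat.Base using (_+_; _*_; _/_; _%_; s<s; ≢-nonZero; ≢-nonZero⁻¹; nonTrivial⇒n>1; n>1⇒nonTrivial)
  open import Data.Nat.Divisibility
  open import Data.Nat.Induction using (<-rec)
  open import Data.Nat.ListAction using (product)
  open import Data.Nat.Primality.Factorisation using (PrimeFactorisation; factorise)
  open import Data.Nat.Properties
  open import Data.Nat.Tactic.RingSolver using (solve-∀)

  ^-distribʳ-* : ∀ m n k → (m * n) ^ k ≡ m ^ k * n ^ k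
  ^-distribʳ-* m n zero = refl
  ^-distribʳ-* m n (suc k) = trans (cong (m * n *_) (^-distribʳ-* m n k)) (lem m n (m ^ k) (n ^ k))
    where
    lem : ∀ a b c d → a * b * (c * d) ≡ a * c * (b * d)
    lem = solve-∀

  n<2^n : ∀ n → n < 2 ^ n
  n<2^n zero    = s≤s z≤n
  n<2^n (suc n) = begin-strict
    suc n            <⟨ s<s (n<2^n n) ⟩
    1 + 2 ^ n        ≤⟨ +-monoˡ-≤ (2 ^ n) (m^n>0 2 n) ⟩
    2 ^ n + 2 ^ n    ≡⟨ cong (2 ^ n +_) (sym (+-identityʳ (2 ^ n))) ⟩
    2 ^ suc n        ∎
    where open ≤-Reasoning

  -- Writing e = r + q k with r < k gives 1 + e ≤ k (1 + q) ≤ k 2^q.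
  [1+e]^k≤k^k*2^e : ∀ k .{{_ : NonZero k}} e → suc e ^ k ≤ k ^ k * 2 ^ e
  [1+e]^k≤k^k*2^e k e = begin
    suc e ^ k                    ≤⟨ ^-monoˡ-≤ k 1+e≤k*2^q ⟩
    (k * 2 ^ (e / k)) ^ k        ≡⟨ ^-distribʳ-* k (2 ^ (e / k)) k ⟩
    k ^ k * (2 ^ (e / k)) ^ k    ≡⟨ cong (k ^ k *_) (^-*-assoc 2 (e / k) k) ⟩
    k ^ k * 2 ^ (e / k * k)      ≤⟨ *-monoʳ-≤ (k ^ k) (^-monoʳ-≤ 2 (m/n*n≤m e k)) ⟩
    k ^ k * 2 ^ e                ∎
    where
    open ≤-Reasoning
    1+e≤k*2^q : suc e ≤ k * 2 ^ (e / k)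
    1+e≤k*2^q = begin
      suc e                      ≡⟨ cong suc (m≡m%n+[m/n]*n e k) ⟩
      suc (e % k) + e / k * k    ≤⟨ +-monoˡ-≤ (e / k * k) (m%n<n e k) ⟩
      suc (e / k) * k            ≡⟨ *-comm (suc (e / k)) k ⟩
      k * suc (e / k)            ≤⟨ *-monoʳ-≤ k (n<2^n (e / k)) ⟩
      k * 2 ^ (e / k)            ∎

  length-cartesianProductWith : ∀ {A B C : Set} (f : A → B → C) xs ys →
                                length (cartesianProductWith f xs ys) ≡ length xs * length ys
  length-cartesianProductWith f []       ys = refl
  length-cartesianProductWith f (x ∷ xs) ys = begin
    length (map (f x) ys ++ cartesianProductWith f xs ys)          ≡⟨ length-++ (map (f x) ys) ⟩
    length (map (f x) ys) + length (cartesianProductWith f xs ys)  ≡⟨ cong₂ _+_ (length-map (f x) ys) (length-cartesianProductWith f xs ys) ⟩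
    length ys + length xs * length ys                              ∎
    where open ≡-Reasoning

  -- The divisor bound without roots: n has at most B^(1/k) divisors. The list may contain
  -- repetitions and non-divisors; only its length counts.
  record DivisorCover (n k B : ℕ) : Set where
    constructor cover
    field
      list   : List ℕ
      covers : ∀ {d} → d ∣ n → d ∈ list
      small  : length list ^ k ≤ B

  open DivisorCover

  ∣-prime-* : ∀ {p} n {d} → Prime p → d ∣ p * n → d ∣ n ⊎ ∃ λ d′ → d ≡ p * d′ × d′ ∣ n
  ∣-prime-* {p} n {d} pp (divides q pn≡qd) with euclidsLemma q d pp (divides n (trans (sym pn≡qd) (*-comm p n)))
    where instance _ = prime⇒nonZero pp
  ... | inj₁ (divides q′ refl) = inj₁ (divides q′ (*-cancelˡ-≡ n (q′ * d) p (trans pn≡qd (lem q′ p d))))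
    where
    instance _ = prime⇒nonZero pp
    lem : ∀ a b c → a * b * c ≡ b * (a * c)
    lem = solve-∀
  ... | inj₂ (divides d′ refl) = inj₂ (d′ , *-comm d′ p , divides q (*-cancelˡ-≡ n (q * d′) p (trans pn≡qd (lem q d′ p))))
    where
    instance _ = prime⇒nonZero pp
    lem : ∀ a b c → a * (b * c) ≡ c * (a * b)
    lem = solve-∀

  -- One more prime factor p at most doubles the number of divisors, hence multiplies its k-th power
  -- by at most 2^k ≤ p.
  roughDivisors : ∀ k ps → All Prime ps → All (2 ^ k ≤_) ps → DivisorCover (product ps) k (product ps)
  roughDivisors k [] _ _ = cover (1 ∷ []) (λ d∣1 → here (∣1⇒≡1 d∣1)) (≤-reflexive (^-zeroˡ k))
  roughDivisors k (p ∷ ps) (pp ∷ pps) (2^k≤p ∷ large)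
    with cover ds ds-covers ds-small ← roughDivisors k ps pps large
    = cover (ds ++ map (p *_) ds) covers′ small′
    where
    covers′ : ∀ {d} → d ∣ p * product ps → d ∈ ds ++ map (p *_) ds
    covers′ d∣pn with ∣-prime-* (product ps) pp d∣pn
    ... | inj₁ d∣n              = ∈-++⁺ˡ (ds-covers d∣n)
    ... | inj₂ (_ , refl , d∣n) = ∈-++⁺ʳ ds (∈-map⁺ (p *_) (ds-covers d∣n))
    small′ : length (ds ++ map (p *_) ds) ^ k ≤ p * product ps
    small′ = begin
      length (ds ++ map (p *_) ds) ^ k            ≡⟨ cong (_^ k) (length-++ ds) ⟩
      (length ds + length (map (p *_) ds)) ^ k    ≡⟨ cong (λ m → (length ds + m) ^ k) (length-map (p *_) ds) ⟩
      (length ds + length ds) ^ k                 ≡⟨ cong (λ m → (length ds + m) ^ k) (sym (+-identityʳ (length ds))) ⟩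
      (2 * length ds) ^ k                         ≡⟨ ^-distribʳ-* 2 (length ds) k ⟩
      2 ^ k * length ds ^ k                       ≤⟨ *-mono-≤ 2^k≤p ds-small ⟩
      p * product ps                              ∎
      where open ≤-Reasoning

  ∣-prime^-* : ∀ {p} e n {d} → Prime p → d ∣ p ^ e * n → ∃₂ λ i d′ → i ≤ e × d′ ∣ n × d ≡ p ^ i * d′
  ∣-prime^-* zero n {d} pp d∣n = 0 , d , z≤n , subst (d ∣_) (+-identityʳ n) d∣n , sym (+-identityʳ d)
  ∣-prime^-* {p} (suc e) n {d} pp d∣
    with ∣-prime-* (p ^ e * n) pp (subst (d ∣_) (*-assoc p (p ^ e) n) d∣)
  ... | inj₁ d∣′ with i , d′ , i≤e , d′∣n , eq ← ∣-prime^-* e n pp d∣′ = i , d′ , m≤n⇒m≤1+n i≤e , d′∣n , eq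
  ... | inj₂ (_ , refl , d∣′) with i , d′ , i≤e , d′∣n , refl ← ∣-prime^-* e n pp d∣′
    = suc i , d′ , s≤s i≤e , d′∣n , sym (*-assoc p (p ^ i) d′)

  split-prime : ∀ {p} → Prime p → ∀ n → .{{NonZero n}} → ∃₂ λ e m → n ≡ p ^ e * m × ¬ p ∣ m × NonZero m
  split-prime {p} pp = <-rec _ go
    where
    go : ∀ n → (∀ {m} → m < n → .{{NonZero m}} → ∃₂ λ e m′ → m ≡ p ^ e * m′ × ¬ p ∣ m′ × NonZero m′) →
         .{{NonZero n}} → ∃₂ λ e m → n ≡ p ^ e * m × ¬ p ∣ m × NonZero m
    go n rec with p ∣? n
    ... | no p∤n = 0 , n , sym (+-identityʳ n) , p∤n , ≢-nonZero (≢-nonZero⁻¹ n)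
    ... | yes p∣n@(divides q refl)
      with e , m , eq , p∤m , m≢0 ← rec {q} (m<m*n q p {{m*n≢0⇒m≢0 q}} (nonTrivial⇒n>1 p {{prime⇒nonTrivial pp}})) {{m*n≢0⇒m≢0 q}}
      = suc e , m , trans (*-comm q p) (trans (cong (p *_) eq) (sym (*-assoc p (p ^ e) m))) , p∤m , m≢0

  -- A divisor of p^e m is p^i d′ with i ≤ e, so the k-th power of the count grows by (1 + e)^k ≤
  -- k^k 2^e ≤ k^k p^e: the factor p^e matches the growth of the number, and k^k is a constant for
  -- each prime removed.
  stripPrime : ∀ k .{{_ : NonZero k}} {p} → Prime p → ∀ e m {B} →
               DivisorCover m k (B * m) → DivisorCover (p ^ e * m) k (k ^ k * B * (p ^ e * m))
  stripPrime k {p} pp e m {B} (cover ds ds-covers ds-small) = cover ds′ covers′ small′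
    where
    ds′ = cartesianProductWith (λ i d → p ^ i * d) (upTo (suc e)) ds
    covers′ : ∀ {d} → d ∣ p ^ e * m → d ∈ ds′
    covers′ d∣ with i , d′ , i≤e , d′∣m , refl ← ∣-prime^-* e m pp d∣
      = ∈-cartesianProductWith⁺ _ (∈-upTo⁺ (s≤s i≤e)) (ds-covers d′∣m)
    2≤p : 2 ≤ p
    2≤p = nonTrivial⇒n>1 p {{prime⇒nonTrivial pp}}
    lem : ∀ a b c d → a * b * (c * d) ≡ a * c * (b * d)
    lem = solve-∀
    small′ : length ds′ ^ k ≤ k ^ k * B * (p ^ e * m)
    small′ = begin
      length ds′ ^ k                          ≡⟨ cong (_^ k) (length-cartesianProductWith (λ i d → p ^ i * d) (upTo (suc e)) ds) ⟩
      (length (upTo (suc e)) * length ds) ^ k ≡⟨ cong (λ l → (l * length ds) ^ k) (length-upTo (suc e)) ⟩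
      (suc e * length ds) ^ k                 ≡⟨ ^-distribʳ-* (suc e) (length ds) k ⟩
      suc e ^ k * length ds ^ k               ≤⟨ *-mono-≤ ([1+e]^k≤k^k*2^e k e) ds-small ⟩
      k ^ k * 2 ^ e * (B * m)                 ≤⟨ *-monoˡ-≤ (B * m) (*-monoʳ-≤ (k ^ k) (^-monoˡ-≤ e 2≤p)) ⟩
      k ^ k * p ^ e * (B * m)                 ≡⟨ lem (k ^ k) (p ^ e) B m ⟩
      k ^ k * B * (p ^ e * m)                 ∎
      where open ≤-Reasoning

  rough⇒large-primes : ∀ {r} ps → All Prime ps → r Rough product ps → All (r ≤_) ps
  rough⇒large-primes [] _ _ = []
  rough⇒large-primes (p ∷ ps) (pp ∷ pps) rough =
    rough⇒≤ {{prime⇒nonTrivial pp}} (rough∧∣⇒rough rough (m∣m*n (product ps))) ∷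
    rough⇒large-primes ps pps (rough∧∣⇒rough rough (n∣m*n p))

  -- Induction on the number j of candidates r, r + 1, ... left below 2^k + 2. Each costs a factor
  -- of at most k^k; beyond them all prime factors are at least 2^k and `roughDivisors` applies.
  divisors-rough : ∀ k .{{_ : NonZero k}} j r → 2 ≤ r → j + r ≡ 2 ^ k + 2 →
                   ∃ λ B → ∀ n → .{{NonZero n}} → r Rough n → DivisorCover n k (B * n)
  divisors-rough k zero r 2≤r eq = 1 , λ n rough → go n rough (factorise n)
    where
    go : ∀ n → r Rough n → PrimeFactorisation n → DivisorCover n k (1 * n)
    go n rough record { factors = ps ; isFactorisation = refl ; factorsPrime = pps }
      = subst (DivisorCover _ k) (sym (+-identityʳ _))
          (roughDivisors k ps pps (All.map (≤-trans (≤-trans (m≤m+n _ 2) (≤-reflexive (sym eq)))) (rough⇒large-primes ps pps rough)))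
  divisors-rough k (suc j) r 2≤r eq
    with B , rec ← divisors-rough k j (suc r) (m≤n⇒m≤1+n 2≤r) (trans (+-suc j r) eq)
    = k ^ k * B , go
    where
    instance
      _ = n>1⇒nonTrivial 2≤r
    go : ∀ n → .{{NonZero n}} → r Rough n → DivisorCover n k (k ^ k * B * n)
    -- A divisor r of an r-rough number is prime. Stripping all its powers leaves a number that is
    -- rough for 1 + r.
    go n rough with r ∣? n
    ... | yes r∣n
      with e , m , refl , r∤m , m≢0 ← split-prime (rough∧∣⇒prime rough r∣n) n
      = stripPrime k (rough∧∣⇒prime rough r∣n) e m
          (rec m {{m≢0}} (∤⇒rough-suc r∤m (rough∧∣⇒rough rough (n∣m*n (r ^ e)))))
    ... | no r∤n with cover ds ds-covers ds-small ← rec n (∤⇒rough-suc r∤n rough)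
      = cover ds ds-covers (≤-trans ds-small (*-monoˡ-≤ n (m≤n*m B (k ^ k) {{m^n≢0 k k}})))

  -- As k is arbitrary, this is the bound n^o(1) for the number of divisors of n.
  divisors : ∀ k .{{_ : NonZero k}} → ∃ λ B → ∀ n → .{{NonZero n}} → DivisorCover n k (B * n)
  divisors k with B , covers ← divisors-rough k (2 ^ k) 2 ≤-refl refl = B , λ n → covers n 2-rough

-- Triples of integers

import Algebra.Properties.AbelianGroup
open import Data.Integer.Base as ℤ using (ℤ; +_; _+_; _-_; _*_; ∣_∣; 0ℤ; 1ℤ)
open import Data.Integer.Divisibility.Signed
open import Data.Integer.GCD using (gcd; gcd-greatest)
import Data.Integer.Properties as ℤ
open import Data.Integer.Tactic.RingSolver using (solve-∀)
import Data.Nat.Divisibility as ℕ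
import Data.Nat.Properties as ℕ
import Data.Nat.Tactic.RingSolver as ℕ
open Algebra.Properties.AbelianGroup ℤ.+-0-abelianGroup using () renaming (∙-cancelˡ to +-cancelˡ)

-- A record, so that i and n can be inferred from i ≼ n.
infix 4 _≼_

record _≼_ (i : ℤ) (n : ℕ) : Set where
  constructor bounded
  field ∣i∣≤n : ∣ i ∣ ≤ n

open _≼_

≼-+ : ∀ {i j m n} → i ≼ m → j ≼ n → i + j ≼ m ℕ.+ n
≼-+ {i} {j} (bounded i≤m) (bounded j≤n) = bounded (ℕ.≤-trans (ℤ.∣i+j∣≤∣i∣+∣j∣ i j) (ℕ.+-mono-≤ i≤m j≤n))

≼-- : ∀ {i j m n} → i ≼ m → j ≼ n → i - j ≼ m ℕ.+ n
≼-- {i} {j} (bounded i≤m) (bounded j≤n) = bounded (ℕ.≤-trans (ℤ.∣i-j∣≤∣i∣+∣j∣ i j) (ℕ.+-mono-≤ i≤m j≤n))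

≼-* : ∀ {i j m n} → i ≼ m → j ≼ n → i * j ≼ m ℕ.* n
≼-* {i} {j} (bounded i≤m) (bounded j≤n) = bounded (ℕ.≤-trans (ℕ.≤-reflexive (ℤ.∣i*j∣≡∣i∣*∣j∣ i j)) (ℕ.*-mono-≤ i≤m j≤n))

≼-trans : ∀ {i m n} → i ≼ m → m ≤ n → i ≼ n
≼-trans (bounded i≤m) m≤n = bounded (ℕ.≤-trans i≤m m≤n)

*≢0 : ∀ {i j} → i ≢ 0ℤ → j ≢ 0ℤ → i * j ≢ 0ℤ
*≢0 {i} i≢0 j≢0 ij≡0 = [ i≢0 , j≢0 ]′ (ℤ.i*j≡0⇒i≡0∨j≡0 i ij≡0)

∣0 : ∀ {i} → i ∣ 0ℤ
∣0 = divides 0ℤ refl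

p∣ij⇒p∣i∨p∣j : ∀ {p} → Prime p → ∀ i j → + p ∣ i * j → (+ p ∣ i) ⊎ (+ p ∣ j)
p∣ij⇒p∣i∨p∣j {p} pp i j p∣ij
  with euclidsLemma ∣ i ∣ ∣ j ∣ pp (subst (p ℕ.∣_) (ℤ.∣i*j∣≡∣i∣*∣j∣ i j) (∣⇒∣ᵤ p∣ij))
... | inj₁ p∣i = inj₁ (∣ᵤ⇒∣ p∣i)
... | inj₂ p∣j = inj₂ (∣ᵤ⇒∣ p∣j)

-- The way from congruences modulo p to equalities of integers: a nonzero multiple of p has absolute
-- value at least p.
∣-small⇒≡0 : ∀ {p i} → + p ∣ i → ∀ {n} → i ≼ n → n < p → i ≡ 0ℤ
∣-small⇒≡0 {p} {i} p∣i (bounded i≤n) n<p with ℕ.≤-<-trans i≤n n<p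
... | i<p with ∣ i ∣ in eq
...   | zero  = ℤ.∣i∣≡0⇒i≡0 eq
...   | suc _ = contradiction (subst (p ℕ.∣_) eq (∣⇒∣ᵤ p∣i)) (ℕ.>⇒∤ i<p)

-- The base may be 0, as the width `W` of a piece can be; 1 ≤ i excludes 0^0 = 1.
^-monoʳ-≤′ : ∀ m {i j} → 1 ≤ i → i ≤ j → m ^ i ≤ m ^ j
^-monoʳ-≤′ zero    {suc i} _ _   = z≤n
^-monoʳ-≤′ (suc m)         _ i≤j = ℕ.^-monoʳ-≤ (suc m) i≤j

Triple : Set
Triple = ℤ × ℤ × ℤ

infix 4 _isIn_ _≟_

_isIn_ : ℤ → Triple → Set
w isIn (x , y , z) = w ≡ x ⊎ w ≡ y ⊎ w ≡ z

_≟_ : (u v : Triple) → Dec (u ≡ v)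
_≟_ = ≡-dec ℤ._≟_ (≡-dec ℤ._≟_ ℤ._≟_)

-- The coefficients of (T + x)(T + y)(T + z) - (T + x′)(T + y′)(T + z′), constant term first.
Δ : Triple → Triple → Triple
Δ (x , y , z) (x′ , y′ , z′) =
  x * y * z - x′ * y′ * z′ ,
  (x * y + y * z + z * x) - (x′ * y′ + y′ * z′ + z′ * x′) ,
  (x + y + z) - (x′ + y′ + z′)

cross : Triple → Triple → Triple
cross (a , b , c) (a′ , b′ , c′) = b * c′ - c * b′ , c * a′ - a * c′ , a * b′ - b * a′

0³ : Triple
0³ = 0ℤ , 0ℤ , 0ℤ

eval : Triple → ℤ → ℤ
eval (a , b , c) T = a + T * b + T * T * c

-- a + bT + cT² at T = -w: the coordinates of v are the roots of (T + x)(T + y)(T + z) up to sign.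
eval⁻ : Triple → ℤ → ℤ
eval⁻ (a , b , c) w = a - b * w + c * w * w

-- At T = L both products are congruent to `l` for points of the hyperbola, which gives each
-- difference the root L modulo p.
eval-Δ : ∀ T x y z x′ y′ z′ → eval (Δ (x , y , z) (x′ , y′ , z′)) T ≡
         (T + x) * (T + y) * (T + z) - (T + x′) * (T + y′) * (T + z′)
eval-Δ = identity
  where
  identity : ∀ T x y z x′ y′ z′ →
    (x * y * z - x′ * y′ * z′)
      + T * ((x * y + y * z + z * x) - (x′ * y′ + y′ * z′ + z′ * x′))
      + T * T * ((x + y + z) - (x′ + y′ + z′)) ≡
    (T + x) * (T + y) * (T + z) - (T + x′) * (T + y′) * (T + z′)
  identity = solve-∀

-- At T = -w the cubic of v vanishes, having the factor T + w. The other cubic leaves the product of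
-- the w - x′, where the sign (-1)³ cancels the minus.
eval⁻-Δ : ∀ {v w} → w isIn v → ∀ x′ y′ z′ →
          eval⁻ (Δ v (x′ , y′ , z′)) w ≡ (w - x′) * (w - y′) * (w - z′)
eval⁻-Δ {x , y , z} (inj₁ refl) = identity x y z
  where
  identity : ∀ x y z x′ y′ z′ →
    (x * y * z - x′ * y′ * z′) - ((x * y + y * z + z * x) - (x′ * y′ + y′ * z′ + z′ * x′)) * x
      + ((x + y + z) - (x′ + y′ + z′)) * x * x ≡ (x - x′) * (x - y′) * (x - z′)
  identity = solve-∀
eval⁻-Δ {x , y , z} (inj₂ (inj₁ refl)) = identity x y z
  where
  identity : ∀ x y z x′ y′ z′ →
    (x * y * z - x′ * y′ * z′) - ((x * y + y * z + z * x) - (x′ * y′ + y′ * z′ + z′ * x′)) * y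
      + ((x + y + z) - (x′ + y′ + z′)) * y * y ≡ (y - x′) * (y - y′) * (y - z′)
  identity = solve-∀
eval⁻-Δ {x , y , z} (inj₂ (inj₂ refl)) = identity x y z
  where
  identity : ∀ x y z x′ y′ z′ →
    (x * y * z - x′ * y′ * z′) - ((x * y + y * z + z * x) - (x′ * y′ + y′ * z′ + z′ * x′)) * z
      + ((x + y + z) - (x′ + y′ + z′)) * z * z ≡ (z - x′) * (z - y′) * (z - z′)
  identity = solve-∀

-- Modulo f every fᵢ is -dᵢgᵢ, so k f₁f₂f₃ is congruent to a multiple of k d₁d₂d₃, which f divides.
∣-shift₃ : ∀ {f k d₁ d₂ d₃} → f ∣ k * (d₁ * d₂ * d₃) → ∀ {f₁ f₂ f₃ g₁ g₂ g₃} →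
           f - f₁ ≡ d₁ * g₁ → f - f₂ ≡ d₂ * g₂ → f - f₃ ≡ d₃ * g₃ → f ∣ k * (f₁ * f₂ * f₃)
∣-shift₃ {f} {k} {d₁} {d₂} {d₃} (divides m eq) {f₁} {f₂} {f₃} {g₁} {g₂} {g₃} eq₁ eq₂ eq₃ =
  divides (s - m * (g₁ * g₂ * g₃)) (begin
    k * (f₁ * f₂ * f₃)                                       ≡⟨ expand k f f₁ f₂ f₃ ⟩
    s * f - k * ((f - f₁) * (f - f₂) * (f - f₃))             ≡⟨ cong (λ i → s * f - k * i) (cong₂ _*_ (cong₂ _*_ eq₁ eq₂) eq₃) ⟩
    s * f - k * (d₁ * g₁ * (d₂ * g₂) * (d₃ * g₃))            ≡⟨ cong (s * f -_) (regroup k d₁ d₂ d₃ g₁ g₂ g₃) ⟩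
    s * f - k * (d₁ * d₂ * d₃) * (g₁ * g₂ * g₃)              ≡⟨ cong (λ i → s * f - i * (g₁ * g₂ * g₃)) eq ⟩
    s * f - m * f * (g₁ * g₂ * g₃)                           ≡⟨ collect s f m (g₁ * g₂ * g₃) ⟩
    (s - m * (g₁ * g₂ * g₃)) * f                             ∎)
  where
  open ≡-Reasoning
  s : ℤ
  s = k * (f * f - f * (f₁ + f₂ + f₃) + (f₁ * f₂ + f₂ * f₃ + f₃ * f₁))
  expand : ∀ k f f₁ f₂ f₃ → k * (f₁ * f₂ * f₃) ≡
    k * (f * f - f * (f₁ + f₂ + f₃) + (f₁ * f₂ + f₂ * f₃ + f₃ * f₁)) * f - k * ((f - f₁) * (f - f₂) * (f - f₃))
  expand = solve-∀
  regroup : ∀ k d₁ d₂ d₃ g₁ g₂ g₃ → k * (d₁ * g₁ * (d₂ * g₂) * (d₃ * g₃)) ≡ k * (d₁ * d₂ * d₃) * (g₁ * g₂ * g₃)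
  regroup = solve-∀
  collect : ∀ s f m g → s * f - m * f * g ≡ (s - m * g) * f
  collect = solve-∀

-- Modulo f := eval⁻ q w, the factor w - x divides f - eval⁻ q x ≡ - eval⁻ q x.
eval⁻-∣ : ∀ q k w x y z → eval⁻ q w ∣ k * ((w - x) * (w - y) * (w - z)) →
          eval⁻ q w ∣ k * (eval⁻ q x * eval⁻ q y * eval⁻ q z)
eval⁻-∣ q@(a , b , c) k w x y z f∣ =
  ∣-shift₃ {eval⁻ q w} {k} {w - x} {w - y} {w - z} f∣
    {eval⁻ q x} {eval⁻ q y} {eval⁻ q z} {c * (w + x) - b} {c * (w + y) - b} {c * (w + z) - b}
    (factor a b c w x) (factor a b c w y) (factor a b c w z)
  where
  factor : ∀ a b c w x → (a - b * w + c * w * w) - (a - b * x + c * x * x) ≡ (w - x) * (c * (w + x) - b)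
  factor = solve-∀

isIn⇒∈ : ∀ {w x y z} → w isIn (x , y , z) → w ∈ x ∷ y ∷ z ∷ []
isIn⇒∈ (inj₁ refl)        = here refl
isIn⇒∈ (inj₂ (inj₁ refl)) = there (here refl)
isIn⇒∈ (inj₂ (inj₂ refl)) = there (there (here refl))

roots-isIn : ∀ {w x y z} → (w - x) * (w - y) * (w - z) ≡ 0ℤ → w isIn (x , y , z)
roots-isIn {w} {x} {y} {z} eq with ℤ.i*j≡0⇒i≡0∨j≡0 ((w - x) * (w - y)) eq
... | inj₂ eq₃ = inj₂ (inj₂ (ℤ.i-j≡0⇒i≡j w z eq₃))
... | inj₁ eq₁₂ with ℤ.i*j≡0⇒i≡0∨j≡0 (w - x) eq₁₂
...   | inj₁ eq₁ = inj₁ (ℤ.i-j≡0⇒i≡j w x eq₁)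
...   | inj₂ eq₂ = inj₂ (inj₁ (ℤ.i-j≡0⇒i≡j w y eq₂))

-- N is a fixed nonzero integer, so by the divisor bound few integers can be coordinates of S.
record Trap (S : List Triple) (B : ℕ) : Set where
  field
    x₀     : Triple
    q      : Triple
    N      : ℤ
    N≢0    : N ≢ 0ℤ
    N≼B    : N ≼ B
    q≢     : proj₁ (proj₂ q) ≢ 0ℤ ⊎ proj₂ (proj₂ q) ≢ 0ℤ
    traps  : ∀ {v w} → v ∈ S → w isIn v → w isIn x₀ ⊎ (eval⁻ q w ∣ N)

-- A small box on the hyperbola

-- 157464 = 54³ is the largest constant needed, from the bound 54M⁴ for each factor of ∏(A x₀ + B) in Rank₂.
module Box
  {p : ℕ} (pp : Prime p) {l : ℤ} (p∤l : ¬ (+ p ∣ l)) (L : ℤ)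
  (M W : ℕ) .{{_ : NonZero M}} (W≤M : W ≤ M)
  (κ : ℕ) (κ-large : 157464 ≤ κ) (κM⁴W⁴<p : κ ℕ.* (M ^ 4 ℕ.* W ^ 4) < p)
  where

  -- Covers every size that is compared with p below: M ≥ 1 lets its exponent grow to 4, while the
  -- exponent of W has to be positive because W = 0 is possible.
  κM^iW^j<p : ∀ {c i j} → c ≤ 157464 → i ≤ 4 → 1 ≤ j → j ≤ 4 → c ℕ.* (M ^ i ℕ.* W ^ j) < p
  κM^iW^j<p c≤ i≤ 1≤j j≤ = ℕ.≤-<-trans
    (ℕ.*-mono-≤ (ℕ.≤-trans c≤ κ-large) (ℕ.*-mono-≤ (ℕ.^-monoʳ-≤ M i≤) (^-monoʳ-≤′ W 1≤j j≤))) κM⁴W⁴<p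

  -- The degree 12 is that of a product of three linear values of size M⁴ in `Rank₂`; the resultants
  -- have degree 11 and the split case has degree 5.
  Bound : ℕ
  Bound = κ ℕ.* M ^ 12

  cM^i≤Bound : ∀ {c i} → c ≤ 157464 → i ≤ 12 → c ℕ.* M ^ i ≤ Bound
  cM^i≤Bound c≤ i≤ = ℕ.*-mono-≤ (ℕ.≤-trans c≤ κ-large) (ℕ.^-monoʳ-≤ M i≤)

  OnHyperbola : Triple → Set
  OnHyperbola (x , y , z) = + p ∣ (L + x) * (L + y) * (L + z) - l

  InBox : Triple → Set
  InBox (x , y , z) = x ≼ M × y ≼ M × z ≼ M

  Close : Triple → Triple → Set
  Close (x , y , z) (x′ , y′ , z′) = x - x′ ≼ W × y - y′ ≼ W × z - z′ ≼ W

  Unit : ℤ → Set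
  Unit w = ¬ (+ p ∣ L + w)

  units : ∀ {x y z} → OnHyperbola (x , y , z) → Unit x × Unit y × Unit z
  units {x} {y} {z} on =
    (λ p∣x → p∤xyz (∣m⇒∣m*n (L + z) (∣m⇒∣m*n (L + y) p∣x))) ,
    (λ p∣y → p∤xyz (∣m⇒∣m*n (L + z) (∣n⇒∣m*n (L + x) p∣y))) ,
    (λ p∣z → p∤xyz (∣n⇒∣m*n ((L + x) * (L + y)) p∣z))
    where
    identity : ∀ a l → a - (a - l) ≡ l
    identity = solve-∀
    p∤xyz : ¬ (+ p ∣ (L + x) * (L + y) * (L + z))
    p∤xyz p∣xyz = p∤l (subst (+ p ∣_) (identity ((L + x) * (L + y) * (L + z)) l) (∣m∣n⇒∣m-n p∣xyz on))

  -- Quadratics of the size of a `Δ` of two close triples, with the root L modulo p. The primed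
  -- bounds replace W by M; they serve for `Bound`, the sharper ones for comparison with p.
  record Relation (q : Triple) : Set where
    field
      bound₀ : proj₁ q ≼ 3 ℕ.* (M ℕ.* M ℕ.* W)
      bound₁ : proj₁ (proj₂ q) ≼ 6 ℕ.* (M ℕ.* W)
      bound₂ : proj₂ (proj₂ q) ≼ 3 ℕ.* W
      root   : + p ∣ eval q L

    bound₀′ : proj₁ q ≼ 3 ℕ.* (M ℕ.* M ℕ.* M)
    bound₀′ = ≼-trans bound₀ (ℕ.*-monoʳ-≤ 3 (ℕ.*-monoʳ-≤ (M ℕ.* M) W≤M))
    bound₁′ : proj₁ (proj₂ q) ≼ 6 ℕ.* (M ℕ.* M)
    bound₁′ = ≼-trans bound₁ (ℕ.*-monoʳ-≤ 6 (ℕ.*-monoʳ-≤ M W≤M))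
    bound₂′ : proj₂ (proj₂ q) ≼ 3 ℕ.* M
    bound₂′ = ≼-trans bound₂ (ℕ.*-monoʳ-≤ 3 W≤M)

    eval⁻-bound : ∀ {w} → w ≼ M → eval⁻ q w ≼ 12 ℕ.* (M ℕ.* M ℕ.* M)
    eval⁻-bound {w} w≼M = subst (eval⁻ q w ≼_) (identity M)
      (≼-+ (≼-- bound₀′ (≼-* bound₁′ w≼M)) (≼-* (≼-* bound₂′ w≼M) w≼M))
      where
      identity : ∀ M → 3 ℕ.* (M ℕ.* M ℕ.* M) ℕ.+ 6 ℕ.* (M ℕ.* M) ℕ.* M ℕ.+ 3 ℕ.* M ℕ.* M ℕ.* M ≡ 12 ℕ.* (M ℕ.* M ℕ.* M)
      identity = ℕ.solve-∀

  open Relation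

  -- When one coordinate is changed at a time, each term of the difference has one factor of size W,
  -- and its other factors are of size M.
  Δ-relation : ∀ {v v′} → OnHyperbola v → OnHyperbola v′ → InBox v → InBox v′ → Close v v′ → Relation (Δ v v′)
  Δ-relation {x , y , z} {x′ , y′ , z′} on on′ (x≼M , y≼M , z≼M) (x′≼M , y′≼M , z′≼M) (xx′ , yy′ , zz′) = record
    { bound₀ = subst₂ _≼_ (split₀ x y z x′ y′ z′) (sum₀ M W)
        (≼-+ (≼-+ (≼-* (≼-* xx′ y≼M) z≼M) (≼-* (≼-* x′≼M yy′) z≼M)) (≼-* (≼-* x′≼M y′≼M) zz′))
    ; bound₁ = subst₂ _≼_ (split₁ x y z x′ y′ z′) (sum₁ M W)
        (≼-+ (≼-+ (≼-* xx′ (≼-+ y≼M z≼M)) (≼-* yy′ (≼-+ x′≼M z≼M))) (≼-* zz′ (≼-+ x′≼M y′≼M)))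
    ; bound₂ = subst₂ _≼_ (split₂ x y z x′ y′ z′) (sum₂ W) (≼-+ (≼-+ xx′ yy′) zz′)
    ; root   = subst (+ p ∣_) (trans (cancel ((L + x) * (L + y) * (L + z)) ((L + x′) * (L + y′) * (L + z′)) l) (sym (eval-Δ L x y z x′ y′ z′))) (∣m∣n⇒∣m-n on on′)
    }
    where
    split₀ : ∀ x y z x′ y′ z′ → (x - x′) * y * z + x′ * (y - y′) * z + x′ * y′ * (z - z′) ≡ x * y * z - x′ * y′ * z′
    split₀ = solve-∀
    split₁ : ∀ x y z x′ y′ z′ → (x - x′) * (y + z) + (y - y′) * (x′ + z) + (z - z′) * (x′ + y′) ≡
                                (x * y + y * z + z * x) - (x′ * y′ + y′ * z′ + z′ * x′)
    split₁ = solve-∀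
    split₂ : ∀ x y z x′ y′ z′ → (x - x′) + (y - y′) + (z - z′) ≡ (x + y + z) - (x′ + y′ + z′)
    split₂ = solve-∀
    cancel : ∀ a b l → (a - l) - (b - l) ≡ a - b
    cancel = solve-∀
    sum₀ : ∀ M W → W ℕ.* M ℕ.* M ℕ.+ M ℕ.* W ℕ.* M ℕ.+ M ℕ.* M ℕ.* W ≡ 3 ℕ.* (M ℕ.* M ℕ.* W)
    sum₀ = ℕ.solve-∀
    sum₁ : ∀ M W → W ℕ.* (M ℕ.+ M) ℕ.+ W ℕ.* (M ℕ.+ M) ℕ.+ W ℕ.* (M ℕ.+ M) ≡ 6 ℕ.* (M ℕ.* W)
    sum₁ = ℕ.solve-∀
    sum₂ : ∀ W → W ℕ.+ W ℕ.+ W ≡ 3 ℕ.* W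
    sum₂ = ℕ.solve-∀

  -- The values at L and at -w differ by (L + w)(b + c(L - w)). The second value is zero, and the
  -- unit L + w cancels.
  eval⁻-root : ∀ {a b c w} → + p ∣ eval (a , b , c) L → Unit w → eval⁻ (a , b , c) w ≡ 0ℤ → + p ∣ b + c * (L - w)
  eval⁻-root {a} {b} {c} {w} p∣ p∤ eq = [ (λ p∣′ → contradiction p∣′ p∤) , id ]′
    (p∣ij⇒p∣i∨p∣j pp (L + w) (b + c * (L - w)) (subst (+ p ∣_) eq′ p∣))
    where
    identity : ∀ a b c L w → a + L * b + L * L * c ≡ (a - b * w + c * w * w) + (L + w) * (b + c * (L - w))
    identity = solve-∀
    eq′ : eval (a , b , c) L ≡ (L + w) * (b + c * (L - w))
    eq′ = trans (identity a b c L w) (trans (cong (_+ (L + w) * (b + c * (L - w))) eq) (ℤ.+-identityˡ ((L + w) * (b + c * (L - w)))))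

  -- As t ≡ sL, a zero would give s(L + w) ≡ 0 modulo p with both factors prime to p.
  coprime-linear : ∀ {s t w} → + p ∣ s * L - t → ¬ (+ p ∣ s) → Unit w → s * w + t ≢ 0ℤ
  coprime-linear {s} {t} {w} p∣sL-t p∤s p∤w eq = [ p∤s , p∤w ]′ (p∣ij⇒p∣i∨p∣j pp s (L + w)
    (subst (+ p ∣_) (identity s L w t) (∣m∣n⇒∣m+n p∣sL-t (subst (+ p ∣_) (sym eq) ∣0))))
    where
    identity : ∀ s L w t → (s * L - t) + (s * w + t) ≡ s * (L + w)
    identity = solve-∀

  linear : ∀ s t w → eval⁻ (t , ℤ.- s , 0ℤ) w ≡ s * w + t
  linear = identity
    where
    identity : ∀ s t w → t - (ℤ.- s) * w + 0ℤ * w * w ≡ s * w + t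
    identity = solve-∀

  module FromBase {S : List Triple}
    (S-on : ∀ {v} → v ∈ S → OnHyperbola v)
    (S-box : ∀ {v} → v ∈ S → InBox v)
    (S-close : ∀ {v v′} → v ∈ S → v′ ∈ S → Close v v′)
    {x₀ y₀ z₀ : ℤ} (v₀∈S : (x₀ , y₀ , z₀) ∈ S)
    where

    v₀ : Triple
    v₀ = x₀ , y₀ , z₀

    Δ₀ : ∀ {v} → v ∈ S → Relation (Δ v v₀)
    Δ₀ v∈S = Δ-relation (S-on v∈S) (S-on v₀∈S) (S-box v∈S) (S-box v₀∈S) (S-close v∈S v₀∈S)

    trap-zero : (∀ {v} → v ∈ S → Δ v v₀ ≡ 0³) → Trap S Bound
    trap-zero Δ≡0 = record
      { x₀    = v₀
      -- Placeholders for q and N: all cubics agree with that of v₀, so the first alternative of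
      -- `traps` always holds.
      ; q     = 0ℤ , 1ℤ , 0ℤ
      ; N     = 1ℤ
      ; N≢0   = λ ()
      ; N≼B   = bounded (ℕ.*-mono-≤ (ℕ.≤-trans (s≤s z≤n) κ-large) (ℕ.m^n>0 M 12))
      ; q≢    = inj₁ λ ()
      ; traps = λ {_} {w} v∈S w∈v → inj₁ (roots-isIn
          (trans (sym (eval⁻-Δ w∈v x₀ y₀ z₀)) (cong (λ q → eval⁻ q w) (Δ≡0 v∈S))))
      }

    -- N is k times the resultant of q with the cubic of v₀, up to sign. The value of `Δ v v₀` is (w
    -- - x₀)(w - y₀)(w - z₀), and `eval⁻-∣` replaces each factor w - x₀ by q(-x₀).
    trap-resultant : ∀ {q} → Relation q → proj₁ (proj₂ q) ≢ 0ℤ ⊎ proj₂ (proj₂ q) ≢ 0ℤ →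
      ∀ {k} → k ≢ 0ℤ → k ≼ 6 ℕ.* (M ℕ.* M) →
      (∀ {v} → v ∈ S → ∀ w → eval⁻ q w ∣ k * eval⁻ (Δ v v₀) w) →
      eval⁻ q x₀ ≢ 0ℤ → eval⁻ q y₀ ≢ 0ℤ → eval⁻ q z₀ ≢ 0ℤ → Trap S Bound
    trap-resultant {q} rel q≢ {k} k≢0 k≼ parallel qx≢0 qy≢0 qz≢0 = record
      { x₀    = v₀
      ; q     = q
      ; N     = k * (eval⁻ q x₀ * eval⁻ q y₀ * eval⁻ q z₀)
      ; N≢0   = *≢0 k≢0 (*≢0 (*≢0 qx≢0 qy≢0) qz≢0)
      ; N≼B   = N≼B (S-box v₀∈S)
      ; q≢    = q≢
      ; traps = λ {_} {w} v∈S w∈v → inj₂ (eval⁻-∣ q k w x₀ y₀ z₀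
          (subst (λ i → eval⁻ q w ∣ k * i) (eval⁻-Δ w∈v x₀ y₀ z₀) (parallel v∈S w)))
      }
      where
      N≼B : InBox v₀ → k * (eval⁻ q x₀ * eval⁻ q y₀ * eval⁻ q z₀) ≼ Bound
      N≼B (x≼M , y≼M , z≼M) = ≼-trans
        (≼-* k≼ (≼-* (≼-* (eval⁻-bound rel x≼M) (eval⁻-bound rel y≼M)) (eval⁻-bound rel z≼M)))
        (ℕ.≤-trans (ℕ.≤-reflexive (identity 6 12 M)) (cM^i≤Bound {6 ℕ.* 12 ℕ.* 12 ℕ.* 12} {11} (ℕ.≤ᵇ⇒≤ _ _ _) (ℕ.≤ᵇ⇒≤ _ _ _)))
        where
        identity : ∀ a b M → a ℕ.* (M ℕ.* M) ℕ.* (b ℕ.* (M ℕ.* M ℕ.* M) ℕ.* (b ℕ.* (M ℕ.* M ℕ.* M)) ℕ.* (b ℕ.* (M ℕ.* M ℕ.* M))) ≡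
          a ℕ.* b ℕ.* b ℕ.* b ℕ.* (M ℕ.* (M ℕ.* (M ℕ.* (M ℕ.* (M ℕ.* (M ℕ.* (M ℕ.* (M ℕ.* (M ℕ.* (M ℕ.* (M ℕ.* 1)))))))))))
        identity = ℕ.solve-∀

    -- Here a + bT + cT² = (T + x)(cT - t), and cL ≡ t modulo p since L + x is a unit.
    trap-split : ∀ {a b c} → Relation (a , b , c) → c ≢ 0ℤ →
      (∀ {v} → v ∈ S → ∀ w → ∃ λ n → c * eval⁻ (Δ v v₀) w ≡ n * eval⁻ (a , b , c) w) →
      ∀ {x y z} → x isIn v₀ → OnHyperbola (x , y , z) → InBox (x , y , z) →
      (∀ w → (w - x₀) * (w - y₀) * (w - z₀) ≡ (w - x) * ((w - y) * (w - z))) →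
      eval⁻ (a , b , c) x ≡ 0ℤ → Trap S Bound
    trap-split {a} {b} {c} rel c≢0 parallel {x} {y} {z} x∈v₀ on (x≼M , y≼M , z≼M) reorder qx≡0 = record
      { x₀    = v₀
      ; q     = t , ℤ.- c , 0ℤ
      ; N     = c * (f y * f z)
      ; N≢0   = *≢0 c≢0 (*≢0 (coprime-linear p∣cL-t p∤c p∤y) (coprime-linear p∣cL-t p∤c p∤z))
      ; N≼B   = ≼-trans (≼-* (bound₂′ rel) (≼-* (f≼ y≼M) (f≼ z≼M)))
                  (ℕ.≤-trans (ℕ.≤-reflexive (identity₂ 3 12 M)) (cM^i≤Bound {3 ℕ.* 12 ℕ.* 12} {5} (ℕ.≤ᵇ⇒≤ _ _ _) (ℕ.≤ᵇ⇒≤ _ _ _)))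
      ; q≢    = inj₁ λ -c≡0 → c≢0 (ℤ.neg-injective -c≡0)
      ; traps = traps
      }
      where
      t : ℤ
      t = c * x - b
      f : ℤ → ℤ
      f w = c * w + t
      p∤x : Unit x
      p∤x = proj₁ (units on)
      p∤y : Unit y
      p∤y = proj₁ (proj₂ (units on))
      p∤z : Unit z
      p∤z = proj₂ (proj₂ (units on))
      p∣cL-t : + p ∣ c * L - t
      p∣cL-t = subst (+ p ∣_) (identity b c L x) (eval⁻-root {a} (root rel) p∤x qx≡0)
        where
        identity : ∀ b c L x → b + c * (L - x) ≡ c * L - (c * x - b)
        identity = solve-∀
      p∤c : ¬ (+ p ∣ c)
      p∤c p∣c = c≢0 (∣-small⇒≡0 p∣c (subst (c ≼_) (identity 3 W) (bound₂ rel))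
        (κM^iW^j<p {3} {0} {1} (ℕ.≤ᵇ⇒≤ _ _ _) z≤n ℕ.≤-refl (ℕ.≤ᵇ⇒≤ _ _ _)))
        where
        identity : ∀ a W → a ℕ.* W ≡ a ℕ.* (1 ℕ.* (W ℕ.* 1))
        identity = ℕ.solve-∀
      f≼ : ∀ {w} → w ≼ M → f w ≼ 12 ℕ.* (M ℕ.* M)
      f≼ {w} w≼M = subst (c * w + (c * x - b) ≼_) (identity M) (≼-+ (≼-* (bound₂′ rel) w≼M) (≼-- (≼-* (bound₂′ rel) x≼M) (bound₁′ rel)))
        where
        identity : ∀ M → 3 ℕ.* M ℕ.* M ℕ.+ (3 ℕ.* M ℕ.* M ℕ.+ 6 ℕ.* (M ℕ.* M)) ≡ 12 ℕ.* (M ℕ.* M)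
        identity = ℕ.solve-∀
      identity₂ : ∀ a b M → a ℕ.* M ℕ.* (b ℕ.* (M ℕ.* M) ℕ.* (b ℕ.* (M ℕ.* M))) ≡
                            a ℕ.* b ℕ.* b ℕ.* (M ℕ.* (M ℕ.* (M ℕ.* (M ℕ.* (M ℕ.* 1)))))
      identity₂ = ℕ.solve-∀
      factor : ∀ w → eval⁻ (a , b , c) w ≡ (w - x) * f w
      factor w = trans (identity a b c w x) (trans (cong (_+ (w - x) * f w) qx≡0) (ℤ.+-identityˡ _))
        where
        identity : ∀ a b c w x → a - b * w + c * w * w ≡ (a - b * x + c * x * x) + (w - x) * (c * w + (c * x - b))
        identity = solve-∀
      traps : ∀ {v w} → v ∈ S → w isIn v → w isIn v₀ ⊎ (eval⁻ (t , ℤ.- c , 0ℤ) w ∣ c * (f y * f z))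
      -- Both sides of the proportionality contain w - x. It cancels unless w = x, which is a
      -- coordinate of v₀.
      traps {v} {w} v∈S w∈v with w ℤ.≟ x
      ... | yes refl = inj₁ x∈v₀
      ... | no w≢x with n , eq ← parallel v∈S w =
        inj₂ (subst (_∣ c * (f y * f z)) (sym (linear c t w)) divides-N)
        where
        instance
          _ = ℤ.≢-nonZero {w - x} (λ w-x≡0 → w≢x (ℤ.i-j≡0⇒i≡j w x w-x≡0))
        swap : ∀ c d e → c * (d * e) ≡ d * (c * e)
        swap = solve-∀
        cancelled : c * ((w - y) * (w - z)) ≡ n * f w
        cancelled = ℤ.*-cancelˡ-≡ (w - x) _ _ (begin
          (w - x) * (c * ((w - y) * (w - z)))    ≡⟨ swap c (w - x) ((w - y) * (w - z)) ⟨
          c * ((w - x) * ((w - y) * (w - z)))    ≡⟨ cong (c *_) (reorder w) ⟨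
          c * ((w - x₀) * (w - y₀) * (w - z₀))   ≡⟨ cong (c *_) (eval⁻-Δ w∈v x₀ y₀ z₀) ⟨
          c * eval⁻ (Δ v v₀) w                   ≡⟨ eq ⟩
          n * eval⁻ (a , b , c) w                ≡⟨ cong (n *_) (factor w) ⟩
          n * ((w - x) * f w)                    ≡⟨ swap n (w - x) (f w) ⟩
          (w - x) * (n * f w)                    ∎)
          where open ≡-Reasoning
        -- Modulo f w, f y ≡ -c(w - y) and f z ≡ -c(w - z), so c · f y · f z ≡ c³(w - y)(w - z), a
        -- multiple of f w by `cancelled`.
        shift : ∀ c w y z t → c * ((c * y + t) * (c * z + t)) ≡
          c * c * (c * ((w - y) * (w - z))) + (c * w + t) * (c * ((c * y + t) - c * (w - z)))
        shift = solve-∀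
        divides-N : f w ∣ c * (f y * f z)
        divides-N = subst (f w ∣_) (sym (shift c w y z t))
          (∣m∣n⇒∣m+n (subst (λ i → f w ∣ c * c * i) (sym cancelled) (∣n⇒∣m*n (c * c) (∣n⇒∣m*n n ∣-refl))) (∣m⇒∣m*n _ ∣-refl))

    -- Differences proportional to one quadratic

    Parallel : Triple → Set
    Parallel q = ∀ {v} → v ∈ S → cross q (Δ v v₀) ≡ 0³

    private
      3M≤6M² : 3 ℕ.* M ≤ 6 ℕ.* (M ℕ.* M)
      3M≤6M² = ℕ.*-mono-≤ {3} {6} (ℕ.≤ᵇ⇒≤ _ _ _) (ℕ.m≤m*n M M)

    -- Cross-multiplication by the leading coefficients: c d = d₂ q holds coefficientwise for
    -- proportional vectors d and q.
    parallel₂ : ∀ {a b c} → Parallel (a , b , c) → ∀ {v} → v ∈ S → ∀ w →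
                ∃ λ n → c * eval⁻ (Δ v v₀) w ≡ n * eval⁻ (a , b , c) w
    parallel₂ {a} {b} {c} parallel {v} v∈S w = d₂ , proof d₀ d₁ d₂
      (cong proj₁ (parallel v∈S)) (cong (proj₁ ∘ proj₂) (parallel v∈S))
      where
      d₀ d₁ d₂ : ℤ
      d₀ = proj₁ (Δ v v₀)
      d₁ = proj₁ (proj₂ (Δ v v₀))
      d₂ = proj₂ (proj₂ (Δ v v₀))
      proof : ∀ d₀ d₁ d₂ → b * d₂ - c * d₁ ≡ 0ℤ → c * d₀ - a * d₂ ≡ 0ℤ →
              c * (d₀ - d₁ * w + d₂ * w * w) ≡ d₂ * (a - b * w + c * w * w)
      proof d₀ d₁ d₂ eq₁ eq₂ = begin
        c * (d₀ - d₁ * w + d₂ * w * w)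
          ≡⟨ identity a b c d₀ d₁ d₂ w ⟩
        d₂ * (a - b * w + c * w * w) + (c * d₀ - a * d₂) + (b * d₂ - c * d₁) * w
          ≡⟨ cong₂ (λ i j → d₂ * (a - b * w + c * w * w) + i + j * w) eq₂ eq₁ ⟩
        d₂ * (a - b * w + c * w * w) + 0ℤ + 0ℤ * w
          ≡⟨ drop (d₂ * (a - b * w + c * w * w)) w ⟩
        d₂ * (a - b * w + c * w * w) ∎
        where
        open ≡-Reasoning
        identity : ∀ a b c d₀ d₁ d₂ w → c * (d₀ - d₁ * w + d₂ * w * w) ≡
          d₂ * (a - b * w + c * w * w) + (c * d₀ - a * d₂) + (b * d₂ - c * d₁) * w
        identity = solve-∀
        drop : ∀ i w → i + 0ℤ + 0ℤ * w ≡ i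
        drop = solve-∀

    -- The same with the middle coefficients, for the case c = 0, where multiplication by c loses
    -- everything.
    parallel₁ : ∀ {a b c} → Parallel (a , b , c) → ∀ {v} → v ∈ S → ∀ w →
                ∃ λ n → b * eval⁻ (Δ v v₀) w ≡ n * eval⁻ (a , b , c) w
    parallel₁ {a} {b} {c} parallel {v} v∈S w = d₁ , proof d₀ d₁ d₂
      (cong proj₁ (parallel v∈S)) (cong (proj₂ ∘ proj₂) (parallel v∈S))
      where
      d₀ d₁ d₂ : ℤ
      d₀ = proj₁ (Δ v v₀)
      d₁ = proj₁ (proj₂ (Δ v v₀))
      d₂ = proj₂ (proj₂ (Δ v v₀))
      proof : ∀ d₀ d₁ d₂ → b * d₂ - c * d₁ ≡ 0ℤ → a * d₁ - b * d₀ ≡ 0ℤ →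
              b * (d₀ - d₁ * w + d₂ * w * w) ≡ d₁ * (a - b * w + c * w * w)
      proof d₀ d₁ d₂ eq₁ eq₂ = begin
        b * (d₀ - d₁ * w + d₂ * w * w)
          ≡⟨ identity a b c d₀ d₁ d₂ w ⟩
        d₁ * (a - b * w + c * w * w) - (a * d₁ - b * d₀) + (b * d₂ - c * d₁) * (w * w)
          ≡⟨ cong₂ (λ i j → d₁ * (a - b * w + c * w * w) - i + j * (w * w)) eq₂ eq₁ ⟩
        d₁ * (a - b * w + c * w * w) - 0ℤ + 0ℤ * (w * w)
          ≡⟨ drop (d₁ * (a - b * w + c * w * w)) w ⟩
        d₁ * (a - b * w + c * w * w) ∎
        where
        open ≡-Reasoning
        identity : ∀ a b c d₀ d₁ d₂ w → b * (d₀ - d₁ * w + d₂ * w * w) ≡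
          d₁ * (a - b * w + c * w * w) - (a * d₁ - b * d₀) + (b * d₂ - c * d₁) * (w * w)
        identity = solve-∀
        drop : ∀ i w → i - 0ℤ + 0ℤ * (w * w) ≡ i
        drop = solve-∀

    -- If q(-x) is nonzero at the coordinates of v₀, so is the resultant. Otherwise c ≠ 0, q has a
    -- factor T + x with x a coordinate of v₀, and the split case applies.
    trap-parallel : ∀ {a b c} → Relation (a , b , c) → (a , b , c) ≢ 0³ → Parallel (a , b , c) → Trap S Bound
    trap-parallel {a} {b} {c} rel q≢0 parallel = go (c ℤ.≟ 0ℤ)
      (eval⁻ (a , b , c) x₀ ℤ.≟ 0ℤ) (eval⁻ (a , b , c) y₀ ℤ.≟ 0ℤ) (eval⁻ (a , b , c) z₀ ℤ.≟ 0ℤ)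
      where
      -- With b = c = 0 the root condition reads p ∣ a, and a is too small to be nonzero, so q would
      -- vanish.
      b≢0 : c ≡ 0ℤ → b ≢ 0ℤ
      b≢0 refl refl = q≢0 (cong (_, 0ℤ , 0ℤ) (∣-small⇒≡0 (subst (+ p ∣_) (identity a L) (root rel))
        (subst (a ≼_) (identity′ 3 M W) (bound₀ rel))
        (κM^iW^j<p {3} {2} {1} (ℕ.≤ᵇ⇒≤ _ _ _) (ℕ.≤ᵇ⇒≤ _ _ _) ℕ.≤-refl (ℕ.≤ᵇ⇒≤ _ _ _))))
        where
        identity : ∀ a L → a + L * 0ℤ + L * L * 0ℤ ≡ a
        identity = solve-∀
        identity′ : ∀ k M W → k ℕ.* (M ℕ.* M ℕ.* W) ≡ k ℕ.* (M ℕ.* (M ℕ.* 1) ℕ.* (W ℕ.* 1))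
        identity′ = ℕ.solve-∀
      -- When c = 0, a zero at a unit leaves p ∣ b by `eval⁻-root`, impossible for the small b ≠ 0.
      linear-≢0 : c ≡ 0ℤ → ∀ {w} → Unit w → eval⁻ (a , b , c) w ≢ 0ℤ
      linear-≢0 c≡0 {w} unit eq = b≢0 c≡0 (∣-small⇒≡0
        (subst (+ p ∣_) (trans (cong (λ c → b + c * (L - w)) c≡0) (identity b (L - w))) (eval⁻-root {a} {b} {c} (root rel) unit eq))
        (subst (b ≼_) (identity′ 6 M W) (bound₁ rel))
        (κM^iW^j<p {6} {1} {1} (ℕ.≤ᵇ⇒≤ _ _ _) (ℕ.≤ᵇ⇒≤ _ _ _) ℕ.≤-refl (ℕ.≤ᵇ⇒≤ _ _ _)))
        where
        identity : ∀ b i → b + 0ℤ * i ≡ b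
        identity = solve-∀
        identity′ : ∀ k M W → k ℕ.* (M ℕ.* W) ≡ k ℕ.* (M ℕ.* 1 ℕ.* (W ℕ.* 1))
        identity′ = ℕ.solve-∀
      on : OnHyperbola v₀
      on = S-on v₀∈S
      box : InBox v₀
      box = S-box v₀∈S
      swap₁₂ : ∀ x y z → x * y * z ≡ y * x * z
      swap₁₂ = solve-∀
      rotate : ∀ x y z → x * y * z ≡ z * x * y
      rotate = solve-∀
      go : Dec (c ≡ 0ℤ) → Dec (eval⁻ (a , b , c) x₀ ≡ 0ℤ) → Dec (eval⁻ (a , b , c) y₀ ≡ 0ℤ) →
           Dec (eval⁻ (a , b , c) z₀ ≡ 0ℤ) → Trap S Bound
      go (yes c≡0) _ _ _ = trap-resultant rel (inj₁ (b≢0 c≡0)) (b≢0 c≡0) (bound₁′ rel)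
        (λ v∈S w → let n , eq = parallel₁ {a} {b} {c} parallel v∈S w in divides n eq)
        (linear-≢0 c≡0 (proj₁ (units on))) (linear-≢0 c≡0 (proj₁ (proj₂ (units on)))) (linear-≢0 c≡0 (proj₂ (proj₂ (units on))))
      -- `trap-split` wants the vanishing coordinate in first place; the cases of y₀ and z₀ permute
      -- the triple accordingly.
      go (no c≢0) (yes qx≡0) _ _ = trap-split rel c≢0 (parallel₂ {a} {b} {c} parallel) (inj₁ refl) on box
        (λ w → ℤ.*-assoc (w - x₀) (w - y₀) (w - z₀)) qx≡0
      go (no c≢0) _ (yes qy≡0) _ = trap-split rel c≢0 (parallel₂ {a} {b} {c} parallel) (inj₂ (inj₁ refl))
        (subst (λ i → + p ∣ i - l) (swap₁₂ (L + x₀) (L + y₀) (L + z₀)) on)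
        (proj₁ (proj₂ box) , proj₁ box , proj₂ (proj₂ box))
        (λ w → trans (swap₁₂ (w - x₀) (w - y₀) (w - z₀)) (ℤ.*-assoc (w - y₀) (w - x₀) (w - z₀))) qy≡0
      go (no c≢0) _ _ (yes qz≡0) = trap-split rel c≢0 (parallel₂ {a} {b} {c} parallel) (inj₂ (inj₂ refl))
        (subst (λ i → + p ∣ i - l) (rotate (L + x₀) (L + y₀) (L + z₀)) on)
        (proj₂ (proj₂ box) , proj₁ box , proj₁ (proj₂ box))
        (λ w → trans (rotate (w - x₀) (w - y₀) (w - z₀)) (ℤ.*-assoc (w - z₀) (w - x₀) (w - y₀))) qz≡0
      go (no c≢0) (no qx≢0) (no qy≢0) (no qz≢0) = trap-resultant rel (inj₂ c≢0) c≢0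
        (≼-trans (bound₂′ rel) 3M≤6M²) (λ v∈S w → let n , eq = parallel₂ {a} {b} {c} parallel v∈S w in divides n eq) qx≢0 qy≢0 qz≢0

    -- Two differences that are not parallel

    module Rank₂ {a b c a′ b′ c′ : ℤ} (rel : Relation (a , b , c)) (rel′ : Relation (a′ , b′ , c′))
      (cross≢0 : cross (a , b , c) (a′ , b′ , c′) ≢ 0³) where

      A B D : ℤ
      A = b * c′ - c * b′
      B = c * a′ - a * c′
      D = a * b′ - b * a′

      A≼ : A ≼ 36 ℕ.* (M ℕ.* W ℕ.* W)
      A≼ = subst (A ≼_) (identity M W) (≼-- (≼-* (bound₁ rel) (bound₂ rel′)) (≼-* (bound₂ rel) (bound₁ rel′)))
        where
        identity : ∀ M W → 6 ℕ.* (M ℕ.* W) ℕ.* (3 ℕ.* W) ℕ.+ 3 ℕ.* W ℕ.* (6 ℕ.* (M ℕ.* W)) ≡ 36 ℕ.* (M ℕ.* W ℕ.* W)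
        identity = ℕ.solve-∀
      B≼ : B ≼ 18 ℕ.* (M ℕ.* M ℕ.* W ℕ.* W)
      B≼ = subst (B ≼_) (identity M W) (≼-- (≼-* (bound₂ rel) (bound₀ rel′)) (≼-* (bound₀ rel) (bound₂ rel′)))
        where
        identity : ∀ M W → 3 ℕ.* W ℕ.* (3 ℕ.* (M ℕ.* M ℕ.* W)) ℕ.+ 3 ℕ.* (M ℕ.* M ℕ.* W) ℕ.* (3 ℕ.* W) ≡ 18 ℕ.* (M ℕ.* M ℕ.* W ℕ.* W)
        identity = ℕ.solve-∀
      D≼ : D ≼ 36 ℕ.* (M ℕ.* M ℕ.* M ℕ.* W ℕ.* W)
      D≼ = subst (D ≼_) (identity M W) (≼-- (≼-* (bound₀ rel) (bound₁ rel′)) (≼-* (bound₁ rel) (bound₀ rel′)))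
        where
        identity : ∀ M W → 3 ℕ.* (M ℕ.* M ℕ.* W) ℕ.* (6 ℕ.* (M ℕ.* W)) ℕ.+ 6 ℕ.* (M ℕ.* W) ℕ.* (3 ℕ.* (M ℕ.* M ℕ.* W)) ≡
                           36 ℕ.* (M ℕ.* M ℕ.* M ℕ.* W ℕ.* W)
        identity = ℕ.solve-∀

      -- Elimination of the T² coefficient from two quadratics with the common root L. Elimination
      -- of the T coefficient gives `p∣D-ALL`, so (A, B, D) is A(1, L, L²) modulo p.
      p∣B-AL : + p ∣ B - A * L
      p∣B-AL = subst (+ p ∣_) (sym (identity a b c a′ b′ c′ L)) (∣m∣n⇒∣m-n (∣n⇒∣m*n c (root rel′)) (∣n⇒∣m*n c′ (root rel)))
        where
        identity : ∀ a b c a′ b′ c′ L → (c * a′ - a * c′) - (b * c′ - c * b′) * L ≡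
          c * (a′ + L * b′ + L * L * c′) - c′ * (a + L * b + L * L * c)
        identity = solve-∀
      p∣D-ALL : + p ∣ D - A * L * L
      p∣D-ALL = subst (+ p ∣_) (sym (identity a b c a′ b′ c′ L)) (∣m∣n⇒∣m-n (∣n⇒∣m*n b′ (root rel)) (∣n⇒∣m*n b (root rel′)))
        where
        identity : ∀ a b c a′ b′ c′ L → (a * b′ - b * a′) - (b * c′ - c * b′) * L * L ≡
          b′ * (a + L * b + L * L * c) - b * (a′ + L * b′ + L * L * c′)
        identity = solve-∀

      -- Otherwise p divides B and D too, and all three are small enough to vanish, against
      -- `cross≢0`.
      p∤A : ¬ (+ p ∣ A)
      p∤A p∣A = cross≢0 (cong₂ _,_ A≡0 (cong₂ _,_ B≡0 D≡0))
        where
        restore : ∀ i j → (i - j) + j ≡ i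
        restore = solve-∀
        power₁ : ∀ k M W → k ℕ.* (M ℕ.* W ℕ.* W) ≡ k ℕ.* (M ℕ.* 1 ℕ.* (W ℕ.* (W ℕ.* 1)))
        power₁ = ℕ.solve-∀
        power₂ : ∀ k M W → k ℕ.* (M ℕ.* M ℕ.* W ℕ.* W) ≡ k ℕ.* (M ℕ.* (M ℕ.* 1) ℕ.* (W ℕ.* (W ℕ.* 1)))
        power₂ = ℕ.solve-∀
        power₃ : ∀ k M W → k ℕ.* (M ℕ.* M ℕ.* M ℕ.* W ℕ.* W) ≡ k ℕ.* (M ℕ.* (M ℕ.* (M ℕ.* 1)) ℕ.* (W ℕ.* (W ℕ.* 1)))
        power₃ = ℕ.solve-∀
        A≡0 : A ≡ 0ℤ
        A≡0 = ∣-small⇒≡0 p∣A (subst (A ≼_) (power₁ 36 M W) A≼)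
          (κM^iW^j<p {36} {1} {2} (ℕ.≤ᵇ⇒≤ _ _ _) (ℕ.≤ᵇ⇒≤ _ _ _) (ℕ.≤ᵇ⇒≤ _ _ _) (ℕ.≤ᵇ⇒≤ _ _ _))
        B≡0 : B ≡ 0ℤ
        B≡0 = ∣-small⇒≡0 (subst (+ p ∣_) (restore B (A * L)) (∣m∣n⇒∣m+n p∣B-AL (∣m⇒∣m*n L p∣A)))
          (subst (B ≼_) (power₂ 18 M W) B≼)
          (κM^iW^j<p {18} {2} {2} (ℕ.≤ᵇ⇒≤ _ _ _) (ℕ.≤ᵇ⇒≤ _ _ _) (ℕ.≤ᵇ⇒≤ _ _ _) (ℕ.≤ᵇ⇒≤ _ _ _))
        D≡0 : D ≡ 0ℤ
        D≡0 = ∣-small⇒≡0 (subst (+ p ∣_) (restore D (A * L * L)) (∣m∣n⇒∣m+n p∣D-ALL (∣m⇒∣m*n L (∣m⇒∣m*n L p∣A))))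
          (subst (D ≼_) (power₃ 36 M W) D≼)
          (κM^iW^j<p {36} {3} {2} (ℕ.≤ᵇ⇒≤ _ _ _) (ℕ.≤ᵇ⇒≤ _ _ _) (ℕ.≤ᵇ⇒≤ _ _ _) (ℕ.≤ᵇ⇒≤ _ _ _))

      -- Modulo p it is A · AL² - (AL)² = 0. Its size M⁴W⁴ is the largest that has to stay below p;
      -- with W about M/K this is M⁸/K⁴, whence the exponent 1/8.
      AD≡BB : A * D - B * B ≡ 0ℤ
      AD≡BB = ∣-small⇒≡0
        (subst (+ p ∣_) (sym (identity A B D L)) (∣m∣n⇒∣m-n (∣n⇒∣m*n A p∣D-ALL) (∣m⇒∣m*n (B + A * L) p∣B-AL)))
        (subst (A * D - B * B ≼_) (identity′ 36 18 36 M W) (≼-- (≼-* A≼ D≼) (≼-* B≼ B≼)))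
        (κM^iW^j<p {36 ℕ.* 36 ℕ.+ 18 ℕ.* 18} {4} {4} (ℕ.≤ᵇ⇒≤ _ _ _) (ℕ.≤ᵇ⇒≤ _ _ _) (ℕ.≤ᵇ⇒≤ _ _ _) (ℕ.≤ᵇ⇒≤ _ _ _))
        where
        identity : ∀ A B D L → A * D - B * B ≡ A * (D - A * L * L) - (B - A * L) * (B + A * L)
        identity = solve-∀
        identity′ : ∀ a b d M W → a ℕ.* (M ℕ.* W ℕ.* W) ℕ.* (d ℕ.* (M ℕ.* M ℕ.* M ℕ.* W ℕ.* W))
            ℕ.+ b ℕ.* (M ℕ.* M ℕ.* W ℕ.* W) ℕ.* (b ℕ.* (M ℕ.* M ℕ.* W ℕ.* W)) ≡
          (a ℕ.* d ℕ.+ b ℕ.* b) ℕ.* (M ℕ.* (M ℕ.* (M ℕ.* (M ℕ.* 1))) ℕ.* (W ℕ.* (W ℕ.* (W ℕ.* (W ℕ.* 1)))))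
        identity′ = ℕ.solve-∀

      -- Modulo p the left side is A(u + Lv + L²w), and L is a root of the quadratic (u, v, w).
      coplanar : ∀ {u v w} → Relation (u , v , w) → A * u + B * v + D * w ≡ 0ℤ
      coplanar {u} {v} {w} r = ∣-small⇒≡0
        (subst (+ p ∣_) (sym (identity A B D L u v w))
          (∣m∣n⇒∣m+n (∣m∣n⇒∣m+n (∣n⇒∣m*n A (root r)) (∣m⇒∣m*n v p∣B-AL)) (∣m⇒∣m*n w p∣D-ALL)))
        (subst (A * u + B * v + D * w ≼_) (identity′ 36 18 36 3 6 3 M W)
          (≼-+ (≼-+ (≼-* A≼ (bound₀ r)) (≼-* B≼ (bound₁ r))) (≼-* D≼ (bound₂ r))))
        (κM^iW^j<p {36 ℕ.* 3 ℕ.+ 18 ℕ.* 6 ℕ.+ 36 ℕ.* 3} {3} {3} (ℕ.≤ᵇ⇒≤ _ _ _) (ℕ.≤ᵇ⇒≤ _ _ _) (ℕ.≤ᵇ⇒≤ _ _ _) (ℕ.≤ᵇ⇒≤ _ _ _))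
        where
        identity : ∀ A B D L u v w → A * u + B * v + D * w ≡
          A * (u + L * v + L * L * w) + (B - A * L) * v + (D - A * L * L) * w
        identity = solve-∀
        identity′ : ∀ a b d e f g M W → a ℕ.* (M ℕ.* W ℕ.* W) ℕ.* (e ℕ.* (M ℕ.* M ℕ.* W))
            ℕ.+ b ℕ.* (M ℕ.* M ℕ.* W ℕ.* W) ℕ.* (f ℕ.* (M ℕ.* W)) ℕ.+ d ℕ.* (M ℕ.* M ℕ.* M ℕ.* W ℕ.* W) ℕ.* (g ℕ.* W) ≡
          (a ℕ.* e ℕ.+ b ℕ.* f ℕ.+ d ℕ.* g) ℕ.* (M ℕ.* (M ℕ.* (M ℕ.* 1)) ℕ.* (W ℕ.* (W ℕ.* (W ℕ.* 1))))
        identity′ = ℕ.solve-∀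

      f : ℤ → ℤ
      f w = A * w + B

      -- By AD = B², the plane A d₀ + B d₁ + D d₂ = 0 consists of the d with d₀ + d₁T + d₂T² vanishing at T = B/A.
      product-constant : ∀ {x y z} → (x , y , z) ∈ S → f x * f y * f z ≡ f x₀ * f y₀ * f z₀
      product-constant {x} {y} {z} v∈S = ℤ.i-j≡0⇒i≡j (f x * f y * f z) (f x₀ * f y₀ * f z₀)
        (trans (identity A B D x y z x₀ y₀ z₀) (trans (cong₂ (λ i j → A * A * i - A * j * d₂) (coplanar (Δ₀ v∈S)) AD≡BB) (zeros A d₂)))
        where
        d₂ : ℤ
        d₂ = (x + y + z) - (x₀ + y₀ + z₀)
        identity : ∀ A B D x y z x′ y′ z′ →
          (A * x + B) * (A * y + B) * (A * z + B) - (A * x′ + B) * (A * y′ + B) * (A * z′ + B) ≡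
          A * A * (A * (x * y * z - x′ * y′ * z′) + B * ((x * y + y * z + z * x) - (x′ * y′ + y′ * z′ + z′ * x′))
            + D * ((x + y + z) - (x′ + y′ + z′)))
            - A * (A * D - B * B) * ((x + y + z) - (x′ + y′ + z′))
        identity = solve-∀
        zeros : ∀ A d → A * A * 0ℤ - A * 0ℤ * d ≡ 0ℤ
        zeros = solve-∀

      f∣ : ∀ {v w} → v ∈ S → w isIn v → f w ∣ f x₀ * f y₀ * f z₀
      f∣ {x , y , z} v∈S (inj₁ refl)        = subst (f x ∣_) (product-constant v∈S) (∣m⇒∣m*n (f z) (∣m⇒∣m*n (f y) ∣-refl))
      f∣ {x , y , z} v∈S (inj₂ (inj₁ refl)) = subst (f y ∣_) (product-constant v∈S) (∣m⇒∣m*n (f z) (∣n⇒∣m*n (f x) ∣-refl))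
      f∣ {x , y , z} v∈S (inj₂ (inj₂ refl)) = subst (f z ∣_) (product-constant v∈S) (∣n⇒∣m*n (f x * f y) ∣-refl)

      f≼ : ∀ {w} → w ≼ M → f w ≼ 54 ℕ.* (M ℕ.* M ℕ.* M ℕ.* M)
      f≼ {w} w≼M = subst (f w ≼_) (identity M) (≼-+
        (≼-* (≼-trans A≼ (ℕ.*-monoʳ-≤ 36 (ℕ.*-mono-≤ (ℕ.*-monoʳ-≤ M W≤M) W≤M))) w≼M)
        (≼-trans B≼ (ℕ.*-monoʳ-≤ 18 (ℕ.*-mono-≤ (ℕ.*-monoʳ-≤ (M ℕ.* M) W≤M) W≤M))))
        where
        identity : ∀ M → 36 ℕ.* (M ℕ.* M ℕ.* M) ℕ.* M ℕ.+ 18 ℕ.* (M ℕ.* M ℕ.* M ℕ.* M) ≡ 54 ℕ.* (M ℕ.* M ℕ.* M ℕ.* M)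
        identity = ℕ.solve-∀

      f≢0 : ∀ {w} → Unit w → f w ≢ 0ℤ
      f≢0 = coprime-linear (subst (+ p ∣_) (identity A B L) (∣m⇒∣-m p∣B-AL)) p∤A
        where
        identity : ∀ A B L → ℤ.- (B - A * L) ≡ A * L - B
        identity = solve-∀

      trap-planar : Trap S Bound
      trap-planar = record
        { x₀    = v₀
        ; q     = B , ℤ.- A , 0ℤ
        ; N     = f x₀ * f y₀ * f z₀
        ; N≢0   = N≢0 (units (S-on v₀∈S))
        ; N≼B   = N≼B (S-box v₀∈S)
        ; q≢    = inj₁ λ -A≡0 → p∤A (subst (+ p ∣_) (sym (ℤ.neg-injective -A≡0)) ∣0)
        ; traps = λ {_} {w} v∈S w∈v → inj₂ (subst (_∣ f x₀ * f y₀ * f z₀) (sym (linear A B w)) (f∣ v∈S w∈v))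
        }
        where
        N≢0 : Unit x₀ × Unit y₀ × Unit z₀ → f x₀ * f y₀ * f z₀ ≢ 0ℤ
        N≢0 (unit-x , unit-y , unit-z) = *≢0 (*≢0 (f≢0 unit-x) (f≢0 unit-y)) (f≢0 unit-z)
        N≼B : InBox v₀ → f x₀ * f y₀ * f z₀ ≼ Bound
        N≼B (x≼M , y≼M , z≼M) = ≼-trans (≼-* (≼-* (f≼ x≼M) (f≼ y≼M)) (f≼ z≼M)) (cube≤Bound 54 (ℕ.≤ᵇ⇒≤ _ _ _))
          where
          identity : ∀ a M → a ℕ.* (M ℕ.* M ℕ.* M ℕ.* M) ℕ.* (a ℕ.* (M ℕ.* M ℕ.* M ℕ.* M)) ℕ.* (a ℕ.* (M ℕ.* M ℕ.* M ℕ.* M)) ≡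
            a ℕ.* a ℕ.* a ℕ.* (M ℕ.* (M ℕ.* (M ℕ.* (M ℕ.* (M ℕ.* (M ℕ.* (M ℕ.* (M ℕ.* (M ℕ.* (M ℕ.* (M ℕ.* (M ℕ.* 1))))))))))))
          identity = ℕ.solve-∀
          cube≤Bound : ∀ a → a ℕ.* a ℕ.* a ≤ 157464 →
            a ℕ.* (M ℕ.* M ℕ.* M ℕ.* M) ℕ.* (a ℕ.* (M ℕ.* M ℕ.* M ℕ.* M)) ℕ.* (a ℕ.* (M ℕ.* M ℕ.* M ℕ.* M)) ≤ Bound
          cube≤Bound a a³≤ = ℕ.≤-trans (ℕ.≤-reflexive (identity a M)) (cM^i≤Bound {a ℕ.* a ℕ.* a} {12} a³≤ (ℕ.≤ᵇ⇒≤ _ _ _))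

    -- The cases are the dimensions 0, 1 and at least 2 of the span of the differences from v₀; S is
    -- finite, so a search decides between them.
    trap : Trap S Bound
    trap with any? (λ v → ¬? (Δ v v₀ ≟ 0³)) S
    ... | no ∄v = trap-zero λ {v} v∈S → decidable-stable (Δ v v₀ ≟ 0³) λ Δ≢0 → ∄v (lose v∈S Δ≢0)
    ... | yes ∃v with v , v∈S , q≢0 ← find ∃v with any? (λ v′ → ¬? (cross (Δ v v₀) (Δ v′ v₀) ≟ 0³)) S
    ...   | no ∄v′ = trap-parallel (Δ₀ v∈S) q≢0 λ {v′} v′∈S →
                      decidable-stable (cross (Δ v v₀) (Δ v′ v₀) ≟ 0³) λ cross≢0 → ∄v′ (lose v′∈S cross≢0)
    ...   | yes ∃v′ with v′ , v′∈S , cross≢0 ← find ∃v′ = Rank₂.trap-planar (Δ₀ v∈S) (Δ₀ v′∈S) cross≢0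

-- Counting the points

^-cancelʳ-≤ : ∀ k .{{_ : NonZero k}} {m n} → m ^ k ≤ n ^ k → m ≤ n
^-cancelʳ-≤ k m^k≤n^k = ℕ.≮⇒≥ λ n<m → ℕ.<⇒≱ (ℕ.^-monoˡ-< k n<m) m^k≤n^k

module _ {A : Set} where

  Unique-⊆⇒length≤ : ∀ {xs ys : List A} → Unique xs → (∀ {x} → x ∈ xs → x ∈ ys) → length xs ≤ length ys
  Unique-⊆⇒length≤ []              _     = z≤n
  Unique-⊆⇒length≤ {x ∷ xs} (x∉xs ∷ unique) xs⊆ys
    with as , bs , refl ← ∈-∃++ (xs⊆ys (here refl)) = begin
      suc (length xs)              ≤⟨ s≤s (Unique-⊆⇒length≤ unique remove) ⟩
      suc (length (as ++ bs))      ≡⟨ cong suc (length-++ as) ⟩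
      suc (length as ℕ.+ length bs) ≡⟨ ℕ.+-suc (length as) (length bs) ⟨
      length as ℕ.+ suc (length bs) ≡⟨ length-++ as ⟨
      length (as ++ x ∷ bs)        ∎
    where
    open ℕ.≤-Reasoning
    remove : ∀ {y} → y ∈ xs → y ∈ as ++ bs
    remove y∈xs with ∈-++⁻ as (xs⊆ys (there y∈xs))
    ... | inj₁ y∈as          = ∈-++⁺ˡ y∈as
    ... | inj₂ (there y∈bs)  = ∈-++⁺ʳ as y∈bs
    ... | inj₂ (here refl)   = contradiction refl (All.lookup x∉xs y∈xs)

  length-concatMap-≤ : ∀ {B : Set} (f : A → List B) {m} xs →
                       (∀ {x} → x ∈ xs → length (f x) ≤ m) → length (concatMap f xs) ≤ length xs ℕ.* m
  length-concatMap-≤ f []       _ = z≤n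
  length-concatMap-≤ f (x ∷ xs) f≤ = ℕ.≤-trans (ℕ.≤-reflexive (length-++ (f x)))
    (ℕ.+-mono-≤ (f≤ (here refl)) (length-concatMap-≤ f xs (f≤ ∘ there)))

  ∈-concatMap : ∀ {B : Set} (f : A → List B) {xs x y} → x ∈ xs → y ∈ f x → y ∈ concatMap f xs
  ∈-concatMap f {x ∷ xs} (here refl) y∈ = ∈-++⁺ˡ y∈
  ∈-concatMap f {x ∷ xs} (there x∈)  y∈ = ∈-++⁺ʳ (f x) (∈-concatMap f x∈ y∈)

  -- B need not be a k-th power; the maximum of the values takes the place of its k-th root.
  uniform-bound : ∀ k .{{_ : NonZero k}} (f : A → ℕ) {B} xs → (∀ x → f x ^ k ≤ B) →
                  ∃ λ m → m ^ k ≤ B × (∀ {x} → x ∈ xs → f x ≤ m)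
  uniform-bound k@(suc _) f [] _ = 0 , z≤n , λ ()
  uniform-bound k f {B} (x ∷ xs) f≤ with m , m≤ , xs≤ ← uniform-bound k f xs f≤
    = f x ⊔ m
    , [ (λ eq → subst (λ n → n ^ k ≤ B) (sym eq) (f≤ x)) , (λ eq → subst (λ n → n ^ k ≤ B) (sym eq) m≤) ]′ (ℕ.⊔-sel (f x) m)
    , λ where
        (here refl) → ℕ.m≤m⊔n (f x) m
        (there x∈)  → ℕ.≤-trans (xs≤ x∈) (ℕ.m≤n⊔m (f x) m)

-- From divisors to coordinates

other-root : ∀ a b c {w r d} → eval⁻ (a , b , c) w ≡ d → eval⁻ (a , b , c) r ≡ d → w ≡ r ⊎ c * (w + r) ≡ b
other-root a b c {w} {r} eq-w eq-r = [ inj₁ ∘ ℤ.i-j≡0⇒i≡j w r , inj₂ ∘ ℤ.i-j≡0⇒i≡j (c * (w + r)) b ]′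
  (ℤ.i*j≡0⇒i≡0∨j≡0 (w - r) (trans (identity a b c w r) (ℤ.i≡j⇒i-j≡0 (trans eq-w (sym eq-r)))))
  where
  identity : ∀ a b c w r → (w - r) * (c * (w + r) - b) ≡ (a - b * w + c * w * w) - (a - b * r + c * r * r)
  identity = solve-∀

other-root-unique : ∀ {b c} → b ≢ 0ℤ ⊎ c ≢ 0ℤ → ∀ {r s w} → c * (s + r) ≡ b → c * (w + r) ≡ b → w ≡ s
other-root-unique {b} {c} bc≢0 {r} {s} {w} eq-s eq-w with c ℤ.≟ 0ℤ
... | yes refl = contradiction refl
  ([ (λ b≢0 → contradiction (trans (sym eq-s) (ℤ.*-zeroˡ (s + r))) b≢0) , id ]′ bc≢0)
... | no c≢0   = ℤ.i-j≡0⇒i≡j w s ([ (λ c≡0 → contradiction c≡0 c≢0) , id ]′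
  (ℤ.i*j≡0⇒i≡0∨j≡0 c (trans (identity c w s r) (ℤ.i≡j⇒i-j≡0 (trans eq-w (sym eq-s))))))
  where
  identity : ∀ c w s r → c * (w - s) ≡ c * (w + r) - c * (s + r)
  identity = solve-∀

-- The roots are searched for in the finite list xs, so no equation has to be solved. Once a root r
-- is found, any other root w satisfies Vieta's relation c(w + r) = b, which determines it.
roots : ∀ q → proj₁ (proj₂ q) ≢ 0ℤ ⊎ proj₂ (proj₂ q) ≢ 0ℤ → (xs : List ℤ) (d : ℤ) →
        ∃ λ rs → length rs ≤ 2 × (∀ {w} → w ∈ xs → eval⁻ q w ≡ d → w ∈ rs)
roots q@(a , b , c) q≢0 xs d = go (any? (λ w → eval⁻ q w ℤ.≟ d) xs)
  where
  go : Dec (Any (λ w → eval⁻ q w ≡ d) xs) → ∃ λ rs → length rs ≤ 2 × (∀ {w} → w ∈ xs → eval⁻ q w ≡ d → w ∈ rs)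
  go (no ∄r)  = [] , z≤n , λ w∈ eq → contradiction (lose w∈ eq) ∄r
  go (yes ∃r) = let r , _ , eq-r = find ∃r in go′ r eq-r (any? (λ w → c * (w + r) ℤ.≟ b) xs)
    where
    go′ : ∀ r → eval⁻ q r ≡ d → Dec (Any (λ w → c * (w + r) ≡ b) xs) →
          ∃ λ rs → length rs ≤ 2 × (∀ {w} → w ∈ xs → eval⁻ q w ≡ d → w ∈ rs)
    go′ r eq-r (no ∄s)  = r ∷ [] , s≤s z≤n , λ w∈ eq-w →
      here ([ id , (λ eq → contradiction (lose w∈ eq) ∄s) ]′ (other-root a b c eq-w eq-r))
    go′ r eq-r (yes ∃s) = let s , _ , eq-s = find ∃s in r ∷ s ∷ [] , ℕ.≤-refl , λ w∈ eq-w →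
      [ here , (λ eq → there (here (other-root-unique q≢0 eq-s eq))) ]′ (other-root a b c eq-w eq-r)

signed : List ℕ → List ℤ
signed ds = map +_ ds ++ map (ℤ.-_ ∘ +_) ds

length-signed : ∀ ds → length (signed ds) ≡ 2 ℕ.* length ds
length-signed ds = begin
  length (signed ds)                                          ≡⟨ length-++ (map +_ ds) ⟩
  length (map +_ ds) ℕ.+ length (map (ℤ.-_ ∘ +_) ds)          ≡⟨ cong₂ ℕ._+_ (length-map +_ ds) (length-map (ℤ.-_ ∘ +_) ds) ⟩
  length ds ℕ.+ length ds                                     ≡⟨ cong (length ds ℕ.+_) (ℕ.+-identityʳ (length ds)) ⟨
  2 ℕ.* length ds                                             ∎
  where open ≡-Reasoning

∈-signed : ∀ {ds} i → ∣ i ∣ ∈ ds → i ∈ signed ds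
∈-signed (+ n)              n∈ = ∈-++⁺ˡ (∈-map⁺ +_ n∈)
∈-signed {ds} ℤ.-[1+ n ]    n∈ = ∈-++⁺ʳ (map +_ ds) (∈-map⁺ (ℤ.-_ ∘ +_) n∈)

coordinates : List Triple → List ℤ
coordinates = concatMap λ (x , y , z) → x ∷ y ∷ z ∷ []

-- Either w is a coordinate of x₀, or q(-w) is a divisor of N up to sign, a value taken at most
-- twice. This makes 3 + 2 · 2n ≤ 7n candidates, with n ≥ 1 because 1 divides N.
coordinate-cover : ∀ {S B k C} → (t : Trap S B) → DivisorCover ∣ Trap.N t ∣ k C →
  ∃₂ λ X n → n ^ k ≤ C × length X ≤ 7 ℕ.* n × (∀ {v w} → v ∈ S → w isIn v → w ∈ X)
coordinate-cover {S} {k = k} {C} t (cover ds ds-covers ds-small) = X , length ds , ds-small , X≤ , X-covers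
  where
  open Trap t
  root-list : ℤ → List ℤ
  root-list d = proj₁ (roots q q≢ (coordinates S) d)
  rs : List ℤ
  rs = concatMap root-list (signed ds)
  base : List ℤ
  base = proj₁ x₀ ∷ proj₁ (proj₂ x₀) ∷ proj₂ (proj₂ x₀) ∷ []
  X : List ℤ
  X = base ++ rs
  1≤ds : 1 ≤ length ds
  1≤ds = ∈-length (ds-covers (ℕ.1∣ ∣ N ∣))
  X≤ : length X ≤ 7 ℕ.* length ds
  X≤ = begin
    3 ℕ.+ length rs                                   ≤⟨ ℕ.+-mono-≤ (ℕ.*-monoʳ-≤ 3 1≤ds)
                                                           (length-concatMap-≤ root-list (signed ds) (λ {d} _ → proj₁ (proj₂ (roots q q≢ (coordinates S) d)))) ⟩
    3 ℕ.* length ds ℕ.+ length (signed ds) ℕ.* 2      ≡⟨ cong (λ n → 3 ℕ.* length ds ℕ.+ n ℕ.* 2) (length-signed ds) ⟩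
    3 ℕ.* length ds ℕ.+ 2 ℕ.* length ds ℕ.* 2         ≡⟨ identity (length ds) ⟩
    7 ℕ.* length ds                                   ∎
    where
    open ℕ.≤-Reasoning
    identity : ∀ n → 3 ℕ.* n ℕ.+ 2 ℕ.* n ℕ.* 2 ≡ 7 ℕ.* n
    identity = ℕ.solve-∀
  X-covers : ∀ {v w} → v ∈ S → w isIn v → w ∈ X
  X-covers {v} {w} v∈S w∈v = [ (λ w∈x₀ → ∈-++⁺ˡ (isIn⇒∈ w∈x₀)) , (λ qw∣N → ∈-++⁺ʳ base (in-rs qw∣N)) ]′ (traps v∈S w∈v)
    where
    in-rs : eval⁻ q w ∣ N → w ∈ rs
    in-rs qw∣N = ∈-concatMap root-list (∈-signed (eval⁻ q w) (ds-covers (∣⇒∣ᵤ qw∣N)))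
      (proj₂ (proj₂ (roots q q≢ (coordinates S) (eval⁻ q w))) (∈-concatMap _ v∈S (isIn⇒∈ w∈v)) refl)

cube : List ℤ → List Triple
cube X = cartesianProduct X (cartesianProduct X X)

length-cube : ∀ X → length (cube X) ≡ length X ^ 3
length-cube X = trans (length-cartesianProductWith _,_ X (cartesianProduct X X)) (cong (length X ℕ.*_)
  (trans (length-cartesianProductWith _,_ X X) (cong (length X ℕ.*_) (sym (ℕ.*-identityʳ (length X))))))

-- The factors 3 and 12 in the exponent pay for the three coordinates and for the degree 12 of the
-- bound on N: n^(36k) ≤ BκM¹² gives n^(3k) ≤ BκM.
trap-cover : ∀ k κ {B M S} (t : Trap S (κ ℕ.* M ^ 12)) →
  DivisorCover ∣ Trap.N t ∣ (3 ℕ.* k ℕ.* 12) (B ℕ.* ∣ Trap.N t ∣) →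
  ∃ λ T → length T ^ k ≤ 7 ^ (3 ℕ.* k) ℕ.* (B ℕ.* κ) ℕ.* M × (∀ {v} → v ∈ S → v ∈ T)
trap-cover k κ {B} {M} {S} t divisor-cover
  with X , n , n≤ , X≤ , X-covers ← coordinate-cover t divisor-cover = cube X , small , covers
  where
  open ℕ.≤-Reasoning
  covers : ∀ {v} → v ∈ S → v ∈ cube X
  covers {x , y , z} v∈S = ∈-cartesianProduct⁺ (X-covers v∈S (inj₁ refl))
    (∈-cartesianProduct⁺ (X-covers v∈S (inj₂ (inj₁ refl))) (X-covers v∈S (inj₂ (inj₂ refl))))
  n^3k≤ : n ^ (3 ℕ.* k) ≤ B ℕ.* κ ℕ.* M
  n^3k≤ = ^-cancelʳ-≤ 12 (begin
    (n ^ (3 ℕ.* k)) ^ 12            ≡⟨ ℕ.^-*-assoc n (3 ℕ.* k) 12 ⟩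
    n ^ (3 ℕ.* k ℕ.* 12)            ≤⟨ n≤ ⟩
    B ℕ.* ∣ Trap.N t ∣              ≤⟨ ℕ.*-monoʳ-≤ B (_≼_.∣i∣≤n (Trap.N≼B t)) ⟩
    B ℕ.* (κ ℕ.* M ^ 12)            ≡⟨ ℕ.*-assoc B κ (M ^ 12) ⟨
    B ℕ.* κ ℕ.* M ^ 12              ≡⟨ cong (ℕ._* M ^ 12) (ℕ.^-identityʳ (B ℕ.* κ)) ⟨
    (B ℕ.* κ) ^ 1 ℕ.* M ^ 12        ≤⟨ ℕ.*-monoˡ-≤ (M ^ 12) (^-monoʳ-≤′ (B ℕ.* κ) {1} {12} ℕ.≤-refl (s≤s z≤n)) ⟩
    (B ℕ.* κ) ^ 12 ℕ.* M ^ 12       ≡⟨ ^-distribʳ-* (B ℕ.* κ) M 12 ⟨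
    (B ℕ.* κ ℕ.* M) ^ 12            ∎)
  small : length (cube X) ^ k ≤ 7 ^ (3 ℕ.* k) ℕ.* (B ℕ.* κ) ℕ.* M
  small = begin
    length (cube X) ^ k                          ≡⟨ cong (_^ k) (length-cube X) ⟩
    (length X ^ 3) ^ k                           ≡⟨ ℕ.^-*-assoc (length X) 3 k ⟩
    length X ^ (3 ℕ.* k)                         ≤⟨ ℕ.^-monoˡ-≤ (3 ℕ.* k) X≤ ⟩
    (7 ℕ.* n) ^ (3 ℕ.* k)                        ≡⟨ ^-distribʳ-* 7 n (3 ℕ.* k) ⟩
    7 ^ (3 ℕ.* k) ℕ.* n ^ (3 ℕ.* k)              ≤⟨ ℕ.*-monoʳ-≤ (7 ^ (3 ℕ.* k)) n^3k≤ ⟩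
    7 ^ (3 ℕ.* k) ℕ.* (B ℕ.* κ ℕ.* M)            ≡⟨ ℕ.*-assoc (7 ^ (3 ℕ.* k)) (B ℕ.* κ) M ⟨
    7 ^ (3 ℕ.* k) ℕ.* (B ℕ.* κ) ℕ.* M            ∎

-- The interval cut into pieces

∈-interval : ∀ {M L X} → X ∈ interval M L → ∃ λ n → n ≤ M × X ≡ L + + n
∈-interval {M} {L} X∈ with i , i∈ , refl ← ∈-map⁻ (λ i → L + + suc i) X∈ = suc i , ∈-upTo⁻ i∈ , refl

interval-unique : ∀ M L → Unique (interval M L)
interval-unique M L = Unique.map⁺ (λ eq → ℕ.suc-injective (ℤ.+-injective (+-cancelˡ L _ _ eq))) (Unique.upTo⁺ M)

-- A fibre of division by 1 + W is a block of 1 + W consecutive integers, with distances at most W.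
-- The divisor 1 + W is nonzero even for W = 0.
same-quotient : ∀ {m n} W → m ℕ./ suc W ≡ n ℕ./ suc W → + m - + n ≼ W
same-quotient {m} {n} W eq = bounded (begin
  ∣ + m - + n ∣                                         ≡⟨ cong₂ (λ i j → ∣ + i - + j ∣) (m≡m%n+[m/n]*n m (suc W)) (m≡m%n+[m/n]*n n (suc W)) ⟩
  ∣ + (m ℕ.% suc W ℕ.+ m ℕ./ suc W ℕ.* suc W) - + (n ℕ.% suc W ℕ.+ n ℕ./ suc W ℕ.* suc W) ∣
    ≡⟨ cong (λ q → ∣ + (m ℕ.% suc W ℕ.+ q ℕ.* suc W) - + (n ℕ.% suc W ℕ.+ n ℕ./ suc W ℕ.* suc W) ∣) eq ⟩
  ∣ + (m ℕ.% suc W ℕ.+ n ℕ./ suc W ℕ.* suc W) - + (n ℕ.% suc W ℕ.+ n ℕ./ suc W ℕ.* suc W) ∣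
    ≡⟨ cong ∣_∣ (identity (+ (m ℕ.% suc W)) (+ (n ℕ.% suc W)) (+ (n ℕ./ suc W ℕ.* suc W))) ⟩
  ∣ + (m ℕ.% suc W) - + (n ℕ.% suc W) ∣                     ≡⟨ cong ∣_∣ (ℤ.m-n≡m⊖n (m ℕ.% suc W) (n ℕ.% suc W)) ⟩
  ∣ m ℕ.% suc W ℤ.⊖ n ℕ.% suc W ∣                           ≤⟨ ℤ.∣m⊝n∣≤m⊔n (m ℕ.% suc W) (n ℕ.% suc W) ⟩
  (m ℕ.% suc W) ⊔ (n ℕ.% suc W)                             ≤⟨ ℕ.⊔-lub (ℕ.≤-pred (m%n<n m (suc W))) (ℕ.≤-pred (m%n<n n (suc W))) ⟩
  W                                                     ∎)
  where
  open ℕ.≤-Reasoning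
  identity : ∀ a b c → (a + c) - (b + c) ≡ a - b
  identity = solve-∀

module Classes (p : ℕ) (l : ℤ) (M : ℕ) (L : ℤ) (W : ℕ) where

  Index : Set
  Index = ℕ × ℕ × ℕ

  _≟ⁱ_ : (c d : Index) → Dec (c ≡ d)
  _≟ⁱ_ = ≡-dec ℕ._≟_ (≡-dec ℕ._≟_ ℕ._≟_)

  offset : Triple → Triple
  offset (x , y , z) = x - L , y - L , z - L

  onset : Triple → Triple
  onset (x , y , z) = L + x , L + y , L + z

  onset-offset : ∀ v → onset (offset v) ≡ v
  onset-offset (x , y , z) = cong₂ _,_ (identity L x) (cong₂ _,_ (identity L y) (identity L z))
    where
    identity : ∀ L x → L + (x - L) ≡ x
    identity = solve-∀

  index : Triple → Index
  index (x , y , z) = ∣ x ∣ ℕ./ suc W , ∣ y ∣ ℕ./ suc W , ∣ z ∣ ℕ./ suc W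

  points : List Triple
  points = filter (λ (x , y , z) → (x * y * z) ≡? l [mod p ])
    (cartesianProduct (interval M L) (cartesianProduct (interval M L) (interval M L)))

  points-unique : Unique points
  points-unique = Unique.filter⁺ _ (Unique.cartesianProduct⁺ (interval-unique M L)
    (Unique.cartesianProduct⁺ (interval-unique M L) (interval-unique M L)))

  record Point (v : Triple) : Set where
    constructor point
    field
      x y z : ℕ
      x≤ : x ≤ M
      y≤ : y ≤ M
      z≤ : z ≤ M
      eq : v ≡ (+ x , + y , + z)
      on : + p ∣ (L + + x) * (L + + y) * (L + + z) - l

  points-Point : ∀ {v} → v ∈ points → Point (offset v)
  points-Point {X , Y , Z} v∈
    with v∈J , on ← ∈-filter⁻ (λ (x , y , z) → (x * y * z) ≡? l [mod p ]) v∈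
    with X∈ , YZ∈ ← ∈-cartesianProduct⁻ (interval M L) _ v∈J
    with Y∈ , Z∈ ← ∈-cartesianProduct⁻ (interval M L) _ YZ∈
    with x , x≤ , refl ← ∈-interval {M} {L} X∈
    with y , y≤ , refl ← ∈-interval {M} {L} Y∈
    with z , z≤ , refl ← ∈-interval {M} {L} Z∈
    = point x y z x≤ y≤ z≤ (cong₂ _,_ (identity L (+ x)) (cong₂ _,_ (identity L (+ y)) (identity L (+ z)))) on
    where
    identity : ∀ L x → (L + x) - L ≡ x
    identity = solve-∀

  class : Index → List Triple
  class c = filter (λ v → index v ≟ⁱ c) (map offset points)

  class⁻ : ∀ {c v} → v ∈ class c → Point v × index v ≡ c
  class⁻ {c} v∈ with v∈′ , eq ← ∈-filter⁻ (λ v → index v ≟ⁱ c) v∈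
    with _ , u∈ , refl ← ∈-map⁻ offset v∈′ = points-Point u∈ , eq

  module _ (pp : Prime p) (p∤l : ¬ (+ p ∣ l)) .{{_ : NonZero M}} (W≤M : W ≤ M) (κ : ℕ)
    (κ-large : 157464 ≤ κ) (κM⁴W⁴<p : κ ℕ.* (M ^ 4 ℕ.* W ^ 4) < p) where

    open Box pp p∤l L M W W≤M κ κ-large κM⁴W⁴<p

    class-trap : ∀ c → class c ≡ [] ⊎ Trap (class c) Bound
    class-trap c = go (class c) class⁻
      where
      on-hyperbola : ∀ {v} → Point v → OnHyperbola v
      on-hyperbola (point _ _ _ _ _ _ refl on) = on
      in-box : ∀ {v} → Point v → InBox v
      in-box (point _ _ _ x≤ y≤ z≤ refl _) = bounded x≤ , bounded y≤ , bounded z≤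
      close : ∀ {v v′} → Point v → Point v′ → index v ≡ index v′ → Close v v′
      close (point x y z _ _ _ refl _) (point x′ y′ z′ _ _ _ refl _) eq =
        same-quotient {x} {x′} W (cong proj₁ eq) ,
        same-quotient {y} {y′} W (cong (proj₁ ∘ proj₂) eq) ,
        same-quotient {z} {z′} W (cong (proj₂ ∘ proj₂) eq)
      go : ∀ S → (∀ {v} → v ∈ S → Point v × index v ≡ c) → S ≡ [] ⊎ Trap S Bound
      go []      _  = inj₁ refl
      -- The first element of the class serves as the base point v₀.
      go (_ ∷ _) S⁻ = inj₂ (FromBase.trap (λ v∈ → on-hyperbola (proj₁ (S⁻ v∈))) (λ v∈ → in-box (proj₁ (S⁻ v∈)))
        (λ v∈ v′∈ → close (proj₁ (S⁻ v∈)) (proj₁ (S⁻ v′∈)) (trans (proj₂ (S⁻ v∈)) (sym (proj₂ (S⁻ v′∈))))) (here refl))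

  module _ (K : ℕ) (M<K*[1+W] : M < K ℕ.* suc W) where

    indices : List Index
    indices = cartesianProduct (upTo K) (cartesianProduct (upTo K) (upTo K))

    length-indices : length indices ≡ K ℕ.* (K ℕ.* K)
    length-indices = trans (length-cartesianProductWith _,_ (upTo K) _) (cong₂ ℕ._*_ (length-upTo K)
      (trans (length-cartesianProductWith _,_ (upTo K) (upTo K)) (cong₂ ℕ._*_ (length-upTo K) (length-upTo K))))

    index∈indices : ∀ {v} → Point v → index v ∈ indices
    index∈indices (point x y z x≤ y≤ z≤ refl _) =
      ∈-cartesianProduct⁺ (in-range x≤) (∈-cartesianProduct⁺ (in-range y≤) (in-range z≤))
      where
      in-range : ∀ {x} → x ≤ M → x ℕ./ suc W ∈ upTo K
      in-range x≤ = ∈-upTo⁺ (m<n*o⇒m/o<n (ℕ.≤-<-trans x≤ M<K*[1+W]))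

    -- There are K³ indices, and the points form a list without repetitions inside the union of the
    -- covers, translated back by L.
    points-bound : ∀ k .{{_ : NonZero k}} {B} →
      (∀ c → ∃ λ T → length T ^ k ≤ B × (∀ {v} → v ∈ class c → v ∈ T)) →
      length points ^ k ≤ (K ℕ.* (K ℕ.* K)) ^ k ℕ.* B
    points-bound k {B} class-cover
      with m , m^k≤B , covers≤m ← uniform-bound k (length ∘ proj₁ ∘ class-cover) indices (proj₁ ∘ proj₂ ∘ class-cover) = begin
        length points ^ k                         ≤⟨ ℕ.^-monoˡ-≤ k (Unique-⊆⇒length≤ points-unique points⊆total) ⟩
        length total ^ k                          ≡⟨ cong (_^ k) (length-map onset (concatMap cover-of indices)) ⟩
        length (concatMap cover-of indices) ^ k   ≤⟨ ℕ.^-monoˡ-≤ k (length-concatMap-≤ cover-of indices covers≤m) ⟩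
        (length indices ℕ.* m) ^ k                ≡⟨ cong (λ n → (n ℕ.* m) ^ k) length-indices ⟩
        (K ℕ.* (K ℕ.* K) ℕ.* m) ^ k               ≡⟨ ^-distribʳ-* (K ℕ.* (K ℕ.* K)) m k ⟩
        (K ℕ.* (K ℕ.* K)) ^ k ℕ.* m ^ k           ≤⟨ ℕ.*-monoʳ-≤ ((K ℕ.* (K ℕ.* K)) ^ k) m^k≤B ⟩
        (K ℕ.* (K ℕ.* K)) ^ k ℕ.* B               ∎
      where
      open ℕ.≤-Reasoning
      cover-of : Index → List Triple
      cover-of = proj₁ ∘ class-cover
      total : List Triple
      total = map onset (concatMap cover-of indices)
      points⊆total : ∀ {v} → v ∈ points → v ∈ total
      points⊆total {v} v∈ = subst (_∈ total) (onset-offset v) (∈-map⁺ onset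
        (∈-concatMap cover-of (index∈indices (points-Point v∈)) (proj₂ (proj₂ (class-cover (index (offset v))))
          (∈-filter⁺ (λ u → index u ≟ⁱ index (offset v)) (∈-map⁺ offset v∈) refl))))

m<n*[1+m/n] : ∀ m n .{{_ : NonZero n}} → m < n ℕ.* suc (m ℕ./ n)
m<n*[1+m/n] m n = begin-strict
  m                          ≡⟨ m≡m%n+[m/n]*n m n ⟩
  m ℕ.% n ℕ.+ m ℕ./ n ℕ.* n      <⟨ ℕ.+-monoˡ-< (m ℕ./ n ℕ.* n) (m%n<n m n) ⟩
  suc (m ℕ./ n) ℕ.* n          ≡⟨ ℕ.*-comm (suc (m ℕ./ n)) n ⟩
  n ℕ.* suc (m ℕ./ n)          ∎
  where open ℕ.≤-Reasoning

-- With W = M/K rounded down, K⁴κM⁴W⁴ ≤ κM⁸ ≤ κCp < Kp ≤ K⁴p.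
quotient-small : ∀ κ K {C} .{{_ : NonZero K}} → κ ℕ.* C < K → ∀ {p} .{{_ : NonZero p}} {M} → M ^ 8 ≤ C ℕ.* p →
                 κ ℕ.* (M ^ 4 ℕ.* (M ℕ./ K) ^ 4) < p
quotient-small κ K {C} κC<K {p} {M} M⁸≤Cp = scale (M ℕ./ K) (m/n*n≤m M K)
  where
  open ℕ.≤-Reasoning
  swap : ∀ a b c d → a ℕ.* (b ℕ.* (c ℕ.* d)) ≡ b ℕ.* (c ℕ.* (d ℕ.* a))
  swap = ℕ.solve-∀
  scale : ∀ W → W ℕ.* K ≤ M → κ ℕ.* (M ^ 4 ℕ.* W ^ 4) < p
  scale W WK≤M = ℕ.*-cancelˡ-< (K ^ 4) (κ ℕ.* (M ^ 4 ℕ.* W ^ 4)) p (begin-strict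
    K ^ 4 ℕ.* (κ ℕ.* (M ^ 4 ℕ.* W ^ 4))       ≡⟨ swap (K ^ 4) κ (M ^ 4) (W ^ 4) ⟩
    κ ℕ.* (M ^ 4 ℕ.* (W ^ 4 ℕ.* K ^ 4))       ≡⟨ cong (λ n → κ ℕ.* (M ^ 4 ℕ.* n)) (^-distribʳ-* W K 4) ⟨
    κ ℕ.* (M ^ 4 ℕ.* (W ℕ.* K) ^ 4)           ≤⟨ ℕ.*-monoʳ-≤ κ (ℕ.*-monoʳ-≤ (M ^ 4) (ℕ.^-monoˡ-≤ 4 WK≤M)) ⟩
    κ ℕ.* (M ^ 4 ℕ.* M ^ 4)                   ≡⟨ cong (κ ℕ.*_) (ℕ.^-distribˡ-+-* M 4 4) ⟨
    κ ℕ.* M ^ 8                               ≤⟨ ℕ.*-monoʳ-≤ κ M⁸≤Cp ⟩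
    κ ℕ.* (C ℕ.* p)                           ≡⟨ ℕ.*-assoc κ C p ⟨
    κ ℕ.* C ℕ.* p                             <⟨ ℕ.*-monoˡ-< p κC<K ⟩
    K ℕ.* p                                   ≡⟨ cong (ℕ._* p) (ℕ.^-identityʳ K) ⟨
    K ^ 1 ℕ.* p                               ≤⟨ ℕ.*-monoˡ-≤ p (ℕ.^-monoʳ-≤ K {1} {4} (s≤s z≤n)) ⟩
    K ^ 4 ℕ.* p                               ∎)

hyperbola-count : ∀ k .{{_ : NonZero k}} κ → 157464 ≤ κ → ∀ C → ∃ λ c → ∀ {p} → Prime p →
  ∀ M .{{_ : NonZero M}} → M ^ 8 ≤ C ℕ.* p → ∀ l → ¬ (+ p ∣ l) → ∀ L → I₃ p l M L ^ k ≤ c ℕ.* M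
hyperbola-count k κ κ-large C =
  -- The number of pieces is K = 1 + κC, as `quotient-small` requires, and is independent of p and
  -- M.
  (suc (κ ℕ.* C) ℕ.* (suc (κ ℕ.* C) ℕ.* suc (κ ℕ.* C))) ^ k ℕ.* B , go (suc (κ ℕ.* C)) (ℕ.n<1+n (κ ℕ.* C))
  where
  instance
    _ = ℕ.m*n≢0 3 k
    _ = ℕ.m*n≢0 (3 ℕ.* k) 12
  D B : ℕ
  D = proj₁ (divisors (3 ℕ.* k ℕ.* 12))
  B = 7 ^ (3 ℕ.* k) ℕ.* (D ℕ.* κ)
  go : ∀ K .{{_ : NonZero K}} → κ ℕ.* C < K → ∀ {p} → Prime p →
       ∀ M .{{_ : NonZero M}} → M ^ 8 ≤ C ℕ.* p → ∀ l → ¬ (+ p ∣ l) → ∀ L →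
       I₃ p l M L ^ k ≤ (K ℕ.* (K ℕ.* K)) ^ k ℕ.* B ℕ.* M
  go K κC<K {p} pp M M⁸≤Cp l p∤l L = ℕ.≤-trans (points-bound K (m<n*[1+m/n] M K) k class-cover)
    (ℕ.≤-reflexive (sym (ℕ.*-assoc ((K ℕ.* (K ℕ.* K)) ^ k) B M)))
    where
    open Classes p l M L (M ℕ./ K)
    class-cover : ∀ c → ∃ λ T → length T ^ k ≤ B ℕ.* M × (∀ {v} → v ∈ class c → v ∈ T)
    class-cover c = [ (λ empty → [] , 0^k≤ k , λ {v} v∈ → subst (v ∈_) empty v∈) , cover-trap ]′
      (class-trap pp p∤l (m/n≤m M K) κ κ-large (quotient-small κ K κC<K {{prime⇒nonZero pp}} {M} M⁸≤Cp) c)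
      where
      cover-trap : Trap (class c) (κ ℕ.* M ^ 12) → ∃ λ T → length T ^ k ≤ B ℕ.* M × (∀ {v} → v ∈ class c → v ∈ T)
      cover-trap t = trap-cover k κ {D} {M} {class c} t (proj₂ (divisors (3 ℕ.* k ℕ.* 12)) ∣ Trap.N t ∣
        {{ℕ.≢-nonZero λ N≡0 → Trap.N≢0 t (ℤ.∣i∣≡0⇒i≡0 N≡0)}})
      0^k≤ : ∀ k .{{_ : NonZero k}} {n} → 0 ^ k ≤ n
      0^k≤ (suc _) = z≤n

-- Rational and real bounds

import Algebra.Definitions.RawSemiring
import Algebra.Properties.CommutativeMonoid.Mult
open import Data.Rational.Base as ℚ using (ℚ; 0ℚ; toℚᵘ; _/_)
import Data.Rational.Properties as ℚ
open import Data.Rational.Unnormalised.Base as ℚᵘ using (mkℚᵘ)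
import Data.Rational.Unnormalised.Properties as ℚᵘ
open Algebra.Definitions.RawSemiring ℚ.+-*-rawSemiring using () renaming (_^_ to _^ℚ_)
open Algebra.Properties.CommutativeMonoid.Mult ℚ.*-1-commutativeMonoid using (×-distrib-+)

frac-< : ∀ {a b c d} → a ℕ.* suc d < c ℕ.* suc b → + a / suc b ℚ.< + c / suc d
frac-< {a} {b} {c} {d} ad<cb = ℚ.toℚᵘ-cancel-< (ℚᵘ.<-respˡ-≃ (ℚᵘ.≃-sym (ℚ.toℚᵘ-fromℚᵘ (mkℚᵘ (+ a) b)))
  (ℚᵘ.<-respʳ-≃ (ℚᵘ.≃-sym (ℚ.toℚᵘ-fromℚᵘ (mkℚᵘ (+ c) d)))
    (ℚᵘ.*<* (subst₂ ℤ._<_ (ℤ.pos-* a (suc d)) (ℤ.pos-* c (suc b)) (ℤ.+<+ ad<cb)))))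

ι : ℕ → ℚ
ι n = + n / 1

ι-* : ∀ m n → ι (m ℕ.* n) ≡ ι m ℚ.* ι n
ι-* m n = ℚ.toℚᵘ-injective (begin
  toℚᵘ (ι (m ℕ.* n))                       ≈⟨ ℚ.toℚᵘ-fromℚᵘ (mkℚᵘ (+ (m ℕ.* n)) 0) ⟩
  mkℚᵘ (+ (m ℕ.* n)) 0                     ≡⟨ cong (λ i → mkℚᵘ i 0) (ℤ.pos-* m n) ⟩
  mkℚᵘ (+ m) 0 ℚᵘ.* mkℚᵘ (+ n) 0           ≈⟨ ℚᵘ.*-cong (ℚ.toℚᵘ-fromℚᵘ (mkℚᵘ (+ m) 0)) (ℚ.toℚᵘ-fromℚᵘ (mkℚᵘ (+ n) 0)) ⟨
  toℚᵘ (ι m) ℚᵘ.* toℚᵘ (ι n)               ≈⟨ ℚ.toℚᵘ-homo-* (ι m) (ι n) ⟨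
  toℚᵘ (ι m ℚ.* ι n)                       ∎)
  where open ℚᵘ.≃-Reasoning

ι-^ : ∀ m k → ι (m ^ k) ≡ ι m ^ℚ k
ι-^ m zero    = refl
ι-^ m (suc k) = trans (ι-* m (m ^ k)) (cong (ι m ℚ.*_) (ι-^ m k))

ι-mono-< : ∀ {m n} → m < n → ι m ℚ.< ι n
ι-mono-< {m} {n} m<n = frac-< {m} {0} {n} {0} (ℕ.*-monoˡ-< 1 m<n)

ι-mono-≤ : ∀ {m n} → m ≤ n → ι m ℚ.≤ ι n
ι-mono-≤ {m} {n} m≤n with m ℕ.≟ n
... | yes refl = ℚ.≤-refl
... | no m≢n   = ℚ.<⇒≤ (ι-mono-< (ℕ.≤∧≢⇒< m≤n m≢n))

ι-cancel-≤ : ∀ {m n} → ι m ℚ.≤ ι n → m ≤ n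
ι-cancel-≤ ιm≤ιn = ℕ.≮⇒≥ λ n<m → ℚ.<-irrefl refl (ℚ.<-≤-trans (ι-mono-< n<m) ιm≤ιn)

^ℚ-mono-≤ : ∀ k {x y} → 0ℚ ℚ.≤ x → x ℚ.≤ y → 0ℚ ℚ.≤ x ^ℚ k × x ^ℚ k ℚ.≤ y ^ℚ k
^ℚ-mono-≤ zero            0≤x x≤y = ℚ.<⇒≤ (ι-mono-< {0} {1} (s≤s z≤n)) , ℚ.≤-refl
^ℚ-mono-≤ (suc k) {x} {y} 0≤x x≤y with 0≤x^k , x^k≤y^k ← ^ℚ-mono-≤ k 0≤x x≤y =
  subst (ℚ._≤ x ℚ.* x ^ℚ k) (ℚ.*-zeroʳ x) (ℚ.*-monoˡ-≤-nonNeg x 0≤x^k) ,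
  ℚ.≤-trans (ℚ.*-monoˡ-≤-nonNeg x x^k≤y^k) (ℚ.*-monoʳ-≤-nonNeg (y ^ℚ k) x≤y)
  where instance
    _ = ℚ.nonNegative 0≤x
    _ = ℚ.nonNegative (ℚ.≤-trans 0≤x^k x^k≤y^k)

^ℚ-distrib-* : ∀ k x y → (x ℚ.* y) ^ℚ k ≡ x ^ℚ k ℚ.* y ^ℚ k
^ℚ-distrib-* k x y = ×-distrib-+ x y k

q<ι : ∀ q → ∃ λ n → q ℚ.< ι (suc n)
q<ι q = ℤ.∣ ℚ.↥ q ∣ , ℚ.toℚᵘ-cancel-< (ℚᵘ.<-respʳ-≃ (ℚᵘ.≃-sym (ℚ.toℚᵘ-fromℚᵘ (mkℚᵘ (+ suc ℤ.∣ ℚ.↥ q ∣) 0))) (ℚᵘ.*<* (bound q)))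
  where
  bound : ∀ q → ℚᵘ.↥ (toℚᵘ q) ℤ.* + 1 ℤ.< + suc ℤ.∣ ℚ.↥ q ∣ ℤ.* ℚᵘ.↧ (toℚᵘ q)
  bound (ℚ.mkℚ (+ n) d _) = subst₂ ℤ._<_ (ℤ.pos-* n 1) (ℤ.pos-* (suc n) (suc d))
    (ℤ.+<+ (ℕ.<-≤-trans (s≤s (ℕ.≤-reflexive (ℕ.*-identityʳ n))) (ℕ.m≤m*n (suc n) (suc d))))
  bound (ℚ.mkℚ ℤ.-[1+ n ] d _) = ℤ.-<+

-- From cuts to integer inequalities

lower<upper : ∀ (x : ℝ) {q r} → lower x q → upper x r → q ℚ.< r
lower<upper x {q} {r} q<x x<r with ℚ.<-cmp q r
... | tri< q<r _ _  = q<r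
... | tri≈ _ refl _ = contradiction (q<x , x<r) (disjoint x)
... | tri> _ _ r<q  = contradiction (q<x , upper-closed x r<q x<r) (disjoint x)

-- 1/k ≤ q < a/(1+b) for a rational q with denominator k between 0 and e.
exponent : ∀ e → Positive e → ∃ λ k → ∀ a b → upper e (+ a / suc b) → suc b ≤ a ℕ.* suc k
exponent e e>0 with lower-open e e>0
... | ℚ.mkℚ (+ zero)   d _ , ℚ.*<* (ℤ.+<+ ()) , _
... | ℚ.mkℚ ℤ.-[1+ _ ] d _ , ℚ.*<* () , _
... | q@(ℚ.mkℚ (+ suc n) d _) , _ , q<e = d , bound
  where
  bound : ∀ a b → upper e (+ a / suc b) → suc b ≤ a ℕ.* suc d
  bound a b e<a/b with ℚᵘ.<-respʳ-≃ (ℚ.toℚᵘ-fromℚᵘ (mkℚᵘ (+ a) b)) (ℚ.toℚᵘ-mono-< (lower<upper e {q} {+ a / suc b} q<e e<a/b))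
  ... | ℚᵘ.*<* lt with subst₂ ℤ._<_ (sym (ℤ.pos-* (suc n) (suc b))) (sym (ℤ.pos-* a (suc d))) lt
  ...   | ℤ.+<+ lt′ = ℕ.≤-trans (ℕ.m≤n*m (suc b) (suc n)) (ℕ.<⇒≤ lt′)

-- Here m is the k-th root of p rounded down and n = m + 1, which is at most 2m since p ≥ 1 forces m
-- ≥ 1. The root is found by induction on p.
integer-root : ∀ k .{{_ : NonZero k}} p .{{_ : NonZero p}} → ∃₂ λ m n → m ^ k ≤ p × p < n ^ k × n ≤ 2 ℕ.* m
integer-root k p = let n , lo , hi = go p in suc n , 2 ℕ.+ n , lo , hi ,
  s≤s (ℕ.≤-trans (ℕ.≤-reflexive (sym (ℕ.+-suc 0 n))) (ℕ.≤-trans (ℕ.m≤n+m (suc n) n) (ℕ.≤-reflexive (cong (n ℕ.+_) (sym (ℕ.+-identityʳ (suc n)))))))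
  where
  go : ∀ p .{{_ : NonZero p}} → ∃ λ n → suc n ^ k ≤ p × p < suc (suc n) ^ k
  go 1 = 0 , ℕ.≤-reflexive (ℕ.^-zeroˡ k) , subst (_< 2 ^ k) (ℕ.^-zeroˡ k) (ℕ.^-monoˡ-< k ℕ.≤-refl)
  go (suc p@(suc _)) = step (go p)
    where
    step : (∃ λ n → suc n ^ k ≤ p × p < suc (suc n) ^ k) → ∃ λ n → suc n ^ k ≤ suc p × suc p < suc (suc n) ^ k
    step (n , lo , hi) with suc p ℕ.<? suc (suc n) ^ k
    ... | yes lt = n , ℕ.m≤n⇒m≤1+n lo , lt
    ... | no ≮   = suc n , ℕ.≮⇒≥ ≮ , ℕ.≤-<-trans hi (ℕ.^-monoˡ-< k (ℕ.n<1+n (suc (suc n))))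

-- With qᵏ > p and m ≥ log₂ p, the number 2q exceeds p^((1+m)/km).
p^[1+m]< : ∀ k .{{_ : NonZero k}} {p q} m .{{_ : NonZero p}} → p < q ^ k → p < 2 ^ m → p ^ suc m < (2 ℕ.* q) ^ (k ℕ.* m)
p^[1+m]< k {p} {q} m p<q^k p<2^m = begin-strict
  p ℕ.* p ^ m                            <⟨ ℕ.*-monoˡ-< (p ^ m) {{ℕ.m^n≢0 p m}} p<2^m ⟩
  2 ^ m ℕ.* p ^ m                        ≤⟨ ℕ.*-mono-≤ (ℕ.^-monoʳ-≤ 2 (ℕ.m≤n*m m k)) (ℕ.^-monoˡ-≤ m (ℕ.<⇒≤ p<q^k)) ⟩
  2 ^ (k ℕ.* m) ℕ.* (q ^ k) ^ m          ≡⟨ cong (2 ^ (k ℕ.* m) ℕ.*_) (ℕ.^-*-assoc q k m) ⟩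
  2 ^ (k ℕ.* m) ℕ.* q ^ (k ℕ.* m)        ≡⟨ ^-distribʳ-* 2 q (k ℕ.* m) ⟨
  (2 ℕ.* q) ^ (k ℕ.* m)                  ∎
  where open ℕ.≤-Reasoning

^ᵘ-1/8 : ∀ {p q} .{{_ : NonZero p}} → p < q ^ 8 → (p ^ᵘ fromℚ (+ 1 / 8)) (ι (2 ℕ.* q))
-- The exponent (1 + p)/(8p) lies just above 1/8: `p-1 ℕ.+ 7 ℕ.* p` is 8p - 1, and p itself serves
-- as the bound for log₂ p.
^ᵘ-1/8 {p@(suc p-1)} {q} p<q⁸ = 0<2q , suc p , p-1 ℕ.+ 7 ℕ.* p , 1/8< , power<
  where
  q≢0 : ∀ {q} → p < q ^ 8 → 0 < q
  q≢0 {suc _} _ = s≤s z≤n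
  0<2q : 0ℚ ℚ.< ι (2 ℕ.* q)
  0<2q = ι-mono-< {0} (ℕ.<-≤-trans (q≢0 p<q⁸) (ℕ.m≤n*m q 2))
  1/8< : + 1 / 8 ℚ.< + suc p / (8 ℕ.* p)
  1/8< = frac-< {1} {7} {suc p} {p-1 ℕ.+ 7 ℕ.* p} (subst₂ _<_ (sym (ℕ.*-identityˡ (8 ℕ.* p))) (ℕ.*-comm 8 (suc p)) (ℕ.*-monoʳ-< 8 (ℕ.n<1+n p)))
  power< : ι p ^ℚ suc p ℚ.< ι (2 ℕ.* q) ^ℚ (8 ℕ.* p)
  power< = subst₂ ℚ._<_ (ι-^ p (suc p)) (ι-^ (2 ℕ.* q) (8 ℕ.* p)) (ι-mono-< (p^[1+m]< 8 {p} {q} p p<q⁸ (n<2^n p)))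

-- An integer c above C replaces it, and p^(1/8) < 2n ≤ 4m with m⁸ ≤ p, so M ≤ 4cm.
eighth-power-bound : ∀ (C : ℝ) → ∃ λ C₁ → ∀ p .{{_ : NonZero p}} M → M ≤ᵘ C *ᵘ p ^ᵘ fromℚ (+ 1 / 8) → M ^ 8 ≤ C₁ ℕ.* p
eighth-power-bound C = (c ℕ.* 4) ^ 8 , λ p M M≤ → bound p M M≤ (integer-root 8 p)
  where
  r : ℚ
  r = proj₁ (upper-inhab C)
  c : ℕ
  c = suc (proj₁ (q<ι r))
  C<c : upper C (ι c)
  C<c = upper-closed C (proj₂ (q<ι r)) (proj₂ (upper-inhab C))
  bound : ∀ p .{{_ : NonZero p}} M → M ≤ᵘ C *ᵘ p ^ᵘ fromℚ (+ 1 / 8) →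
          (∃₂ λ m n → m ^ 8 ≤ p × p < n ^ 8 × n ≤ 2 ℕ.* m) → M ^ 8 ≤ (c ℕ.* 4) ^ 8 ℕ.* p
  bound p M M≤ (m , n , m⁸≤p , p<n⁸ , n≤2m) = begin
    M ^ 8                              ≤⟨ ℕ.^-monoˡ-≤ 8 M≤c*4*m ⟩
    (c ℕ.* 4 ℕ.* m) ^ 8                ≡⟨ ^-distribʳ-* (c ℕ.* 4) m 8 ⟩
    (c ℕ.* 4) ^ 8 ℕ.* m ^ 8            ≤⟨ ℕ.*-monoʳ-≤ ((c ℕ.* 4) ^ 8) m⁸≤p ⟩
    (c ℕ.* 4) ^ 8 ℕ.* p                ∎
    where
    open ℕ.≤-Reasoning
    M≤c*4*m : M ≤ c ℕ.* 4 ℕ.* m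
    M≤c*4*m = begin
      M                                ≤⟨ ι-cancel-≤ (M≤ (ι (c ℕ.* (2 ℕ.* n))) (ι c , ι (2 ℕ.* n) , C<c ,
                                            ^ᵘ-1/8 {p} {n} p<n⁸ , ℚ.≤-reflexive (sym (ι-* c (2 ℕ.* n))))) ⟩
      c ℕ.* (2 ℕ.* n)                  ≤⟨ ℕ.*-monoʳ-≤ c (ℕ.*-monoʳ-≤ 2 n≤2m) ⟩
      c ℕ.* (2 ℕ.* (2 ℕ.* m))          ≡⟨ identity c m ⟩
      c ℕ.* 4 ℕ.* m                    ∎
      where
      identity : ∀ c m → c ℕ.* (2 ℕ.* (2 ℕ.* m)) ≡ c ℕ.* 4 ℕ.* m
      identity = ℕ.solve-∀

power-scaling : ∀ k .{{_ : NonZero k}} c M .{{_ : NonZero M}} {I} a n → I ^ k ≤ c ℕ.* M → n ≤ a ℕ.* k →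
                I ^ n ≤ suc c ^ n ℕ.* M ^ a
power-scaling k c M {I} a n I^k≤cM n≤ak = ^-cancelʳ-≤ k (begin
  (I ^ n) ^ k                            ≡⟨ ^-^-comm I n k ⟩
  (I ^ k) ^ n                            ≤⟨ ℕ.^-monoˡ-≤ n I^k≤cM ⟩
  (c ℕ.* M) ^ n                          ≡⟨ ^-distribʳ-* c M n ⟩
  c ^ n ℕ.* M ^ n                        ≤⟨ ℕ.*-mono-≤ (ℕ.^-monoˡ-≤ n c≤) (ℕ.^-monoʳ-≤ M n≤ak) ⟩
  (suc c ^ k) ^ n ℕ.* M ^ (a ℕ.* k)      ≡⟨ cong₂ ℕ._*_ (^-^-comm (suc c) k n) (sym (ℕ.^-*-assoc M a k)) ⟩
  (suc c ^ n) ^ k ℕ.* (M ^ a) ^ k        ≡⟨ ^-distribʳ-* (suc c ^ n) (M ^ a) k ⟨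
  (suc c ^ n ℕ.* M ^ a) ^ k              ∎)
  where
  open ℕ.≤-Reasoning
  ^-^-comm : ∀ x m n → (x ^ m) ^ n ≡ (x ^ n) ^ m
  ^-^-comm x m n = trans (ℕ.^-*-assoc x m n) (trans (cong (x ^_) (ℕ.*-comm m n)) (sym (ℕ.^-*-assoc x n m)))
  c≤ : c ≤ suc c ^ k
  c≤ = ℕ.≤-trans (ℕ.n≤1+n c) (subst (_≤ suc c ^ k) (ℕ.^-identityʳ (suc c)) (ℕ.^-monoʳ-≤ (suc c) (ℕ.>-nonZero⁻¹ k)))

-- If r < I, then c′t ≤ st ≤ r < I for c′ = 1 + c, and the n-th powers give the contradiction
-- (c′t)^n ≤ I^n ≤ c′^n M^a < (c′t)^n.
≤ᵘ-intro : ∀ k .{{_ : NonZero k}} {e} → (∀ a b → upper e (+ a / suc b) → suc b ≤ a ℕ.* k) →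
           ∀ {c M} .{{_ : NonZero M}} {I} → I ^ k ≤ c ℕ.* M → I ≤ᵘ fromℚ (ι (suc c)) *ᵘ M ^ᵘ e
≤ᵘ-intro k exponents {c} {M} {I} I^k≤cM r (s , t , c<s , (0<t , a , b , e<a/b , M^a<t^b) , st≤r) = ℚ.≮⇒≥ λ r<I →
  ℚ.<-irrefl refl (begin-strict
    (ι c′ ℚ.* t) ^ℚ n                   ≤⟨ proj₂ (^ℚ-mono-≤ n 0≤ct (ℚ.<⇒≤ (ℚ.≤-<-trans ct≤r r<I))) ⟩
    ι I ^ℚ n                            ≡⟨ ι-^ I n ⟨
    ι (I ^ n)                           ≤⟨ ι-mono-≤ (power-scaling k c M a n I^k≤cM (exponents a b e<a/b)) ⟩
    ι (c′ ^ n ℕ.* M ^ a)                ≡⟨ ι-* (c′ ^ n) (M ^ a) ⟩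
    ι (c′ ^ n) ℚ.* ι (M ^ a)            ≡⟨ cong (ι (c′ ^ n) ℚ.*_) (ι-^ M a) ⟩
    ι (c′ ^ n) ℚ.* ι M ^ℚ a             <⟨ ℚ.*-monoʳ-<-pos (ι (c′ ^ n)) {{c′^n>0}} M^a<t^b ⟩
    ι (c′ ^ n) ℚ.* t ^ℚ n               ≡⟨ cong (ℚ._* t ^ℚ n) (ι-^ c′ n) ⟩
    ι c′ ^ℚ n ℚ.* t ^ℚ n                ≡⟨ ^ℚ-distrib-* n (ι c′) t ⟨
    (ι c′ ℚ.* t) ^ℚ n                   ∎)
  where
  open ℚ.≤-Reasoning
  c′ n : ℕ
  c′ = suc c
  n = suc b
  c′^n>0 : ℚ.Positive (ι (c′ ^ n))
  c′^n>0 = ℚ.positive (ι-mono-< (ℕ.m^n>0 c′ n))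
  ct≤r : ι c′ ℚ.* t ℚ.≤ r
  ct≤r = ℚ.≤-trans (ℚ.*-monoʳ-≤-nonNeg t {{ℚ.nonNegative (ℚ.<⇒≤ 0<t)}} (ℚ.<⇒≤ c<s)) st≤r
  0≤ct : 0ℚ ℚ.≤ ι c′ ℚ.* t
  0≤ct = subst (ℚ._≤ ι c′ ℚ.* t) (ℚ.*-zeroʳ (ι c′))
    (ℚ.*-monoˡ-≤-nonNeg (ι c′) {{ℚ.nonNegative (ι-mono-≤ {0} {c′} z≤n)}} (ℚ.<⇒≤ 0<t))

gcd≡1⇒∤ : ∀ {p} → Prime p → ∀ {l} → gcd l (+ p) ≡ 1ℤ → ¬ (+ p ∣ l)
gcd≡1⇒∤ {p} pp {l} gcd≡1 p∣l = ¬prime[1] (subst Prime (ℕ.∣1⇒≡1 (subst (p ℕ.∣_) (cong ℤ.∣_∣ gcd≡1)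
  (gcd-greatest {l} {+ p} {+ p} (∣⇒∣ᵤ p∣l) ℕ.∣-refl))) pp)

Bounded-count : ℕ → ℕ → ℕ → Set
Bounded-count k C c = ∀ {p} → Prime p → ∀ M .{{_ : NonZero M}} → M ^ 8 ≤ C ℕ.* p →
  ∀ l → ¬ (+ p ∣ l) → ∀ L → I₃ p l M L ^ k ≤ c ℕ.* M

bounded-count : ∀ k .{{_ : NonZero k}} C → ∃ (Bounded-count k C)
bounded-count k C = hyperbola-count k 157464 ℕ.≤-refl C

bounded-count⇒≤ᵘ : (C ε : ℝ) → ∀ k .{{_ : NonZero k}} → (∀ a b → upper ε (+ a / suc b) → suc b ≤ a ℕ.* k) →
  ∀ C₁ → (∀ p .{{_ : NonZero p}} M → M ≤ᵘ C *ᵘ p ^ᵘ fromℚ (+ 1 / 8) → M ^ 8 ≤ C₁ ℕ.* p) → ∃ (Bounded-count k C₁) →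
    ∃₂ λ (p₀ : ℕ) (c : ℝ) → Positive c ×
    ((p : ℕ) → Prime p → p₀ ≤ p →
    (M : ℕ) → 1 ≤ M → M ≤ p → M ≤ᵘ C *ᵘ p ^ᵘ fromℚ (+ 1 / 8) →
    (l : ℤ) → gcd l (+ p) ≡ 1ℤ →
    (L : ℤ) → I₃ p l M L ≤ᵘ c *ᵘ M ^ᵘ ε)
-- The count holds at every prime, so the threshold is 0; the constant is 1 + c because c itself
-- could be 0.
bounded-count⇒≤ᵘ C ε k exponents C₁ M⁸≤ (c , count) = 0 , fromℚ (ι (suc c)) , ι-mono-< {0} {suc c} (s≤s z≤n) ,
  λ p pp _ M 1≤M _ M≤ l gcd≡1 L → ≤ᵘ-intro k {ε} exponents {c} {M} {{>-nonZero 1≤M}}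
    (count {p} pp M {{>-nonZero 1≤M}} (M⁸≤ p {{prime⇒nonZero pp}} M M≤) l (gcd≡1⇒∤ pp {l} gcd≡1) L)

theorem2 : (C ε : ℝ) → Positive C → Positive ε →
    ∃₂ λ (p₀ : ℕ) (c : ℝ) → Positive c ×
    ((p : ℕ) → Prime p → p₀ ≤ p →
    (M : ℕ) → 1 ≤ M → M ≤ p → M ≤ᵘ C *ᵘ p ^ᵘ fromℚ (+ 1 / 8) →
    (l : ℤ) → gcd l (+ p) ≡ 1ℤ →
    (L : ℤ) → I₃ p l M L ≤ᵘ c *ᵘ M ^ᵘ ε)
-- Here k is chosen with 1/k below ε, and the count bounds I₃ by (cM)^(1/k).
theorem2 C ε _ ε>0 = bounded-count⇒≤ᵘ C ε (suc (proj₁ (exponent ε ε>0))) (proj₂ (exponent ε ε>0))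
  (proj₁ (eighth-power-bound C)) (proj₂ (eighth-power-bound C))
  (bounded-count (suc (proj₁ (exponent ε ε>0))) (proj₁ (eighth-power-bound C)))
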